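{- Let $G\in\mathcal E$ be reduced in $\mathcal E$. If $G'\in\mathcal E$ and $G'\equiv_{\mathcal E}G$, then $\operatorname{rank}(G')\geq\operatorname{rank}(G)$.
   Context: All games are short two-player partizan games between Left and Right, identified with their game trees: $G=\{G^{\mathcal L}\mid G^{\mathcal R}\}$ with finite sets of options; $\mathbf 0=\{\;\mid\;\}$. Rank of $G$: height of its game tree. Followers of $G$: $G$, its options, their options, etc. Disjunctive sum: $G+H=\{G^{\mathcal L}+H,G+H^{\mathcal L}\mid G^{\mathcal R}+H,G+H^{\mathcal R}\}$; conjugate $\overline G=\{\overline{G^{\mathcal R}}\mid\overline{G^{\mathcal L}}\}$. Misère play: a player with no move on their turn wins. $o_L(G)=\mathrm L$ if $G^{\mathcal L}=\emptyset$, else $\max_{G^L}o_R(G^L)$; $o_R(G)=\mathrm R$ if $G^{\mathcal R}=\emptyset$, else $\min_{G^R}o_L(G^R)$; $\mathrm L>\mathrm R$; $o(G)=(o_L(G),o_R(G))$ ordered componentwise. A Left-end has no Left option; a dead Left-end has only Left-ends as followers; similarly Right. A game is dead-ending if each follower that is a Left-end (Right-end) is a dead Left-end (dead Right-end); $\mathcal E$ is the class of dead-ending games. $G\geq_{\mathcal E}H$ means $o(G+X)\geq o(H+X)$ for all $X\in\mathcal E$; $\equiv_{\mathcal E}$ means both directions. Perfect murders: $M_0=\mathbf 0$, $M_n=\{\;\mid\mathbf 0,M_{n-1}\}$. Strong outcomes: $\hat o_L(K)=\min\{o_L(K+X):X\in\mathcal E\text{ a Left-end}\}$, $\hat o_R(K)=\max\{o_R(K+Y):Y\in\mathcal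 E\text{ a Right-end}\}$. For a game $K$: a Left option $A$ is end-reversible if it has a Right option $B$ with no Left options and $B\leq_{\mathcal E}K$; open-reversible if it has a Right option $B\leq_{\mathcal E}K$ having a Left option. Right option $C$: end-reversible if it has a Left option $D$ with no Right options and $D\geq_{\mathcal E}K$; open-reversible if it has a Left option $D\geq_{\mathcal E}K$ having a Right option. Left option $A$ is fundamental if $\hat o_L(K)=\mathrm L$ and $\hat o_L(\{K^{\mathcal L}\setminus\{A\}\mid K^{\mathcal R}\})=\mathrm R$; Right option $C$ is fundamental if $\hat o_R(K)=\mathrm R$ and $\hat o_R(\{K^{\mathcal L}\mid K^{\mathcal R}\setminus\{C\}\})=\mathrm L$. $K\in\mathcal E$ is locally reduced if none of: (R1) distinct $A,B\in K^{\mathcal L}$ with $A\leq_{\mathcal E}B$, or distinct $A,B\in K^{\mathcal R}$ with $A\geq_{\mathcal E}B$; (R2) an open-reversible option; (R3) a non-fundamental end-reversible Left option $A$ with $\{K^{\mathcal L}\setminus\{A\}\mid K^{\mathcal R}\}\in\mathcal E$, or non-fundamental end-reversible Right option $C$ with $\{K^{\mathcal L}\mid K^{\mathcal R}\setminus\{C\}\}\in\mathcal E$; (R4) $K=\{A\mid C\}$ with single options both end-reversible; (R5) an end-reversible Left option not identical to $\{\;\mid M_n\}$, $n$ least nonnegative with $K\geq_{\mathcal E}M_n$, or an end-reversible Right option not identical to $\{\overline{M_n}\mid\;\}$, $n$ least nonnegative with $K\leq_{\mathcal E}\overline{M_n}$. $G\in\mathcal E$ is reduced in $\mathcal E$ if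 every follower of $G$ is locally reduced. -}

module Defs where

open import Data.Nat using (ℕ; zero; suc; _⊔_; _<_; _≤_)
open import Data.Bool using (Bool; true; false; _∧_; _∨_; if_then_else_)
open import Data.List using (List; []; _∷_; _++_)
open import Data.List.Membership.Propositional using (_∈_)
open import Data.Product using (Σ; ∃; _×_; _,_)
open import Data.Sum using (_⊎_)
open import Relation.Nullary using (¬_)
open import Relation.Binary.PropositionalEquality using (_≡_)

-- Games as finite game trees  G = { G^L | G^R }.
-- Option *sets* are represented by lists; lists that contain the same
-- games up to identity (see `ident`) represent the same game.

data Game : Set where
  ⟨_∣_⟩ : List Game → List Game → Game

leftOpts : Game → List Game
leftOpts ⟨ L ∣ _ ⟩ = L

rightOpts : Game → List Game
rightOpts ⟨ _ ∣ R ⟩ = R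

𝟎 : Game
𝟎 = ⟨ [] ∣ [] ⟩

mutual
  ident : Game → Game → Bool
  ident ⟨ L ∣ R ⟩ ⟨ L' ∣ R' ⟩ =
    subI L L' ∧ subI L' L ∧ subI R R' ∧ subI R' R

  subI : List Game → List Game → Bool
  subI [] ys = true
  subI (x ∷ xs) ys = anyI x ys ∧ subI xs ys

  anyI : Game → List Game → Bool
  anyI x [] = false
  anyI x (y ∷ ys) = ident x y ∨ anyI x ys

_≅_ : Game → Game → Set
G ≅ H = ident G H ≡ true

removeI : Game → List Game → List Game
removeI A [] = []
removeI A (x ∷ xs) = if ident x A then removeI A xs else x ∷ removeI A xs

mutual
  rank : Game → ℕ
  rank ⟨ [] ∣ [] ⟩ = 0
  rank ⟨ L ∣ R ⟩ = suc (maxRank L ⊔ maxRank R)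

  maxRank : List Game → ℕ
  maxRank [] = 0
  maxRank (x ∷ xs) = rank x ⊔ maxRank xs

mutual
  _+_ : Game → Game → Game
  g@(⟨ GL ∣ GR ⟩) + h@(⟨ HL ∣ HR ⟩) =
    ⟨ addR GL h ++ addL g HL ∣ addR GR h ++ addL g HR ⟩

  addR : List Game → Game → List Game
  addR [] h = []
  addR (x ∷ xs) h = (x + h) ∷ addR xs h

  addL : Game → List Game → List Game
  addL g [] = []
  addL g (y ∷ ys) = (g + y) ∷ addL g ys

mutual
  conj : Game → Game
  conj ⟨ L ∣ R ⟩ = ⟨ conjs R ∣ conjs L ⟩

  conjs : List Game → List Game
  conjs [] = []
  conjs (x ∷ xs) = conj x ∷ conjs xs

-- Misère outcomes,  L > R

data Outcome : Set where
  L R : Outcome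

_⊔O_ : Outcome → Outcome → Outcome
L ⊔O _ = L
R ⊔O o = o

_⊓O_ : Outcome → Outcome → Outcome
R ⊓O _ = R
L ⊓O o = o

data _≤O_ : Outcome → Outcome → Set where
  R≤ : ∀ {o} → R ≤O o
  L≤L : L ≤O L

mutual
  oL : Game → Outcome
  oL ⟨ [] ∣ _ ⟩ = L
  oL ⟨ x ∷ xs ∣ _ ⟩ = maxOR (x ∷ xs)

  oR : Game → Outcome
  oR ⟨ _ ∣ [] ⟩ = R
  oR ⟨ _ ∣ y ∷ ys ⟩ = minOL (y ∷ ys)

  maxOR : List Game → Outcome
  maxOR [] = R
  maxOR (x ∷ xs) = oR x ⊔O maxOR xs

  minOL : List Game → Outcome
  minOL [] = L
  minOL (x ∷ xs) = oL x ⊓O minOL xs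

_≥o_ : Game → Game → Set
G ≥o H = (oL H ≤O oL G) × (oR H ≤O oR G)

data Follower : Game → Game → Set where
  here  : ∀ {G} → Follower G G
  viaL  : ∀ {H G' G} → G' ∈ leftOpts G → Follower H G' → Follower H G
  viaR  : ∀ {H G' G} → G' ∈ rightOpts G → Follower H G' → Follower H G

LeftEnd : Game → Set
LeftEnd G = leftOpts G ≡ []

RightEnd : Game → Set
RightEnd G = rightOpts G ≡ []

DeadLeftEnd : Game → Set
DeadLeftEnd G = ∀ H → Follower H G → LeftEnd H

DeadRightEnd : Game → Set
DeadRightEnd G = ∀ H → Follower H G → RightEnd H

DeadEnding : Game → Set
DeadEnding G = ∀ H → Follower H G →
  (LeftEnd H → DeadLeftEnd H) × (RightEnd H → DeadRightEnd H)

_≥E_ : Game → Game → Set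
G ≥E H = ∀ X → DeadEnding X → (G + X) ≥o (H + X)

_≤E_ : Game → Game → Set
G ≤E H = H ≥E G

_≡E_ : Game → Game → Set
G ≡E H = (G ≥E H) × (H ≥E G)

M : ℕ → Game
M zero = 𝟎
M (suc n) = ⟨ [] ∣ 𝟎 ∷ M n ∷ [] ⟩

-- Strong outcomes (min / max over the class, stated as propositions)

ôL≡L : Game → Set
ôL≡L K = ∀ X → DeadEnding X → LeftEnd X → oL (K + X) ≡ L

-- ô_L(K) = R  (the minimum is attained: some X gives R)
ôL≡R : Game → Set
ôL≡R K = ∃ λ X → DeadEnding X × LeftEnd X × (oL (K + X) ≡ R)

ôR≡R : Game → Set
ôR≡R K = ∀ Y → DeadEnding Y → RightEnd Y → oR (K + Y) ≡ R

ôR≡L : Game → Set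
ôR≡L K = ∃ λ Y → DeadEnding Y × RightEnd Y × (oR (K + Y) ≡ L)

LEndRev : Game → Game → Set
LEndRev K A = ∃ λ B → B ∈ rightOpts A × LeftEnd B × (B ≤E K)

LOpenRev : Game → Game → Set
LOpenRev K A = ∃ λ B → B ∈ rightOpts A × (B ≤E K) × (∃ λ B' → B' ∈ leftOpts B)

REndRev : Game → Game → Set
REndRev K C = ∃ λ D → D ∈ leftOpts C × RightEnd D × (D ≥E K)

ROpenRev : Game → Game → Set
ROpenRev K C = ∃ λ D → D ∈ leftOpts C × (D ≥E K) × (∃ λ D' → D' ∈ rightOpts D)

delL : Game → Game → Game
delL K A = ⟨ removeI A (leftOpts K) ∣ rightOpts K ⟩

delR : Game → Game → Game
delR K C = ⟨ leftOpts K ∣ removeI C (rightOpts K) ⟩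

LFundamental : Game → Game → Set
LFundamental K A = ôL≡L K × ôL≡R (delL K A)

RFundamental : Game → Game → Set
RFundamental K C = ôR≡R K × ôR≡L (delR K C)

LeastAboveM : Game → ℕ → Set
LeastAboveM K n = (K ≥E M n) × (∀ m → m < n → ¬ (K ≥E M m))

LeastBelowM̄ : Game → ℕ → Set
LeastBelowM̄ K n = (K ≤E conj (M n)) × (∀ m → m < n → ¬ (K ≤E conj (M m)))

IsSingleton : List Game → Game → Set
IsSingleton S A = A ∈ S × (∀ x → x ∈ S → x ≅ A)

R1 : Game → Set
R1 K = (∃ λ A → ∃ λ B → A ∈ leftOpts K × B ∈ leftOpts K × ¬ (A ≅ B) × (A ≤E B))
     ⊎ (∃ λ A → ∃ λ B → A ∈ rightOpts K × B ∈ rightOpts K × ¬ (A ≅ B) × (A ≥E B))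

R2 : Game → Set
R2 K = (∃ λ A → A ∈ leftOpts K × LOpenRev K A)
     ⊎ (∃ λ C → C ∈ rightOpts K × ROpenRev K C)

R3 : Game → Set
R3 K = (∃ λ A → A ∈ leftOpts K × LEndRev K A × ¬ LFundamental K A × DeadEnding (delL K A))
     ⊎ (∃ λ C → C ∈ rightOpts K × REndRev K C × ¬ RFundamental K C × DeadEnding (delR K C))

R4 : Game → Set
R4 K = ∃ λ A → ∃ λ C → IsSingleton (leftOpts K) A × IsSingleton (rightOpts K) C
         × LEndRev K A × REndRev K C

R5 : Game → Set
R5 K = (∃ λ A → A ∈ leftOpts K × LEndRev K A ×
          (∃ λ n → LeastAboveM K n × ¬ (A ≅ ⟨ [] ∣ M n ∷ [] ⟩)))
     ⊎ (∃ λ C → C ∈ rightOpts K × REndRev K C ×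
          (∃ λ n → LeastBelowM̄ K n × ¬ (C ≅ ⟨ conj (M n) ∷ [] ∣ [] ⟩)))

LocallyReduced : Game → Set
LocallyReduced K = DeadEnding K × ¬ (R1 K ⊎ R2 K ⊎ R3 K ⊎ R4 K ⊎ R5 K)

Reduced : Game → Set
Reduced G = DeadEnding G × (∀ H → Follower H G → LocallyReduced H)

{-# OPTIONS --safe #-}
module Submission where

-- The conclusion is decidable, so the argument may be classical; it runs in the
-- double-negation monad. Let G be reduced and G' equivalent to G. The key fact about the
-- order is that G ≥ H forces, for each Left option h of H, a Left option of G above h or a
-- Right option of h below G. Applied alternately to G ≥ G' and G' ≥ G:
--
-- * An irreversible Left option A of G lies below some Left option X of G'; following
--   replies, one either returns to G, where A is undominated, or descends strictly in
--   G', so some proper follower of G' is equivalent to A. Induction compares the ranks.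
-- * A reversible Left option is { | M n } with n least such that G ≥ M n. If G' has a Left
--   option, then a Left option of G' that wins in the context witnessing that A is
--   fundamental leads, along winning replies, to a Left-end B ≤ G with
--   rank B ≤ rank G' - 2, and n ≤ rank B because B ≥ M (rank B).
-- * If G' is a Left-end, so is G: else every Left option of G is the same reversible one,
--   and since it is not fundamental, deleting it must leave the dead-ending class. But the
--   Right options of G match those of G', hence are Left-ends by induction; a reversible
--   one would have to be fundamental or the only one, and both are excluded.
--
-- Right options are handled by conjugation.

open import Defs
open import Data.Nat using (ℕ; zero; suc; _≤_; _<_; z≤n; s≤s; s≤s⁻¹)
open import Data.Nat.Properties
  using (≤-refl; ≤-trans; ≤-antisym; ≤-<-trans; <-≤-trans; <⇒≤; ≮⇒≥; _<?_;
         n<1+n; m≤m⊔n; m≤n⊔m; ⊔-lub)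
open import Data.Bool using (true; false; _∧_; _∨_; _≟_)
open import Data.Bool.Properties using (∧-conicalˡ; ∧-conicalʳ; ∧-assoc; ∧-comm)
open import Data.Empty using (⊥; ⊥-elim)
open import Data.List using (List; []; _∷_; _++_; map)
open import Data.List.Membership.Propositional using (_∈_)
open import Data.List.Membership.Propositional.Properties
  using (∈-++⁺ˡ; ∈-++⁺ʳ; ∈-++⁻; ∈-map⁺; ∈-map⁻)
open import Data.List.Relation.Unary.Any using (here; there)
open import Data.Product using (∃; _×_; _,_; proj₁; proj₂)
open import Data.Unit using (⊤)
open import Data.Sum using (_⊎_; inj₁; inj₂)
open import Function using (_∘_; id)
open import Relation.Nullary using (¬_; yes; no; contradiction)
open import Relation.Nullary.Decidable using (decidable-stable; ¬¬-excluded-middle)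
open import Relation.Binary.PropositionalEquality
  using (_≡_; refl; sym; trans; cong; cong₂; subst; module ≡-Reasoning)

private
  variable
    A B : Set
    G H K X Y x y : Game
    xs ys : List Game

-- Double negation, finite choice and induction on games

pure : A → ¬ ¬ A
pure a k = k a

_>>=_ : ¬ ¬ A → (A → ¬ ¬ B) → ¬ ¬ B
(m >>= f) k = m λ a → f a k

absurd : ¬ ¬ ⊥ → ⊥
absurd m = m id

-- Finite choice survives under double negation. `P` ties a witness to its own `x`, while `Q` is
-- asked of every witness collected, because the list of witnesses becomes an option set of a single
-- context.
choose : {P : Game → Game → Set} {Q : Game → Set} (xs : List Game) →
  (∀ {x} → x ∈ xs → ¬ ¬ ∃ λ y → P x y × Q y) →
  ¬ ¬ ∃ λ ys → (∀ {x} → x ∈ xs → ∃ λ y → y ∈ ys × P x y) × (∀ {y} → y ∈ ys → Q y)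
choose [] f = pure ([] , (λ ()) , λ ())
choose {P} {Q} (x ∷ xs) f = do
  y , Pxy , Qy ← f (here refl)
  ys , h , q ← choose {P} {Q} xs (f ∘ there)
  pure (y ∷ ys
       , (λ { (here refl) → y , here refl , Pxy
            ; (there p) → let z , z∈ , Pz = h p in z , there z∈ , Pz })
       , λ { (here refl) → Qy ; (there p) → q p })

[]-stable : ¬ ¬ (xs ≡ []) → xs ≡ []
[]-stable {xs = []} _ = refl
[]-stable {xs = x ∷ xs} ¬¬e = ⊥-elim (¬¬e λ ())

empty-or-∈ : (xs : List Game) → xs ≡ [] ⊎ ∃ λ x → x ∈ xs
empty-or-∈ [] = inj₁ refl
empty-or-∈ (x ∷ xs) = inj₂ (x , here refl)

∉-[] : xs ≡ [] → ¬ (x ∈ xs)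
∉-[] refl ()

game-ind : (P : Game → Set) →
  (∀ G → (∀ {x} → x ∈ leftOpts G → P x) → (∀ {x} → x ∈ rightOpts G → P x) → P G) →
  ∀ G → P G
list-ind : (P : Game → Set) →
  (∀ G → (∀ {x} → x ∈ leftOpts G → P x) → (∀ {x} → x ∈ rightOpts G → P x) → P G) →
  ∀ xs {x} → x ∈ xs → P x
game-ind P f ⟨ xs ∣ ys ⟩ = f _ (list-ind P f xs) (list-ind P f ys)
list-ind P f (x ∷ xs) (here refl) = game-ind P f x
list-ind P f (x ∷ xs) (there p) = list-ind P f xs p

-- Options of disjunctive sums

addR≡map : ∀ xs H → addR xs H ≡ map (_+ H) xs
addR≡map [] H = refl
addR≡map (x ∷ xs) H = cong (_ ∷_) (addR≡map xs H)

addL≡map : ∀ G xs → addL G xs ≡ map (G +_) xs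
addL≡map G [] = refl
addL≡map G (x ∷ xs) = cong (_ ∷_) (addL≡map G xs)

left-+ : ∀ G H → leftOpts (G + H) ≡ map (_+ H) (leftOpts G) ++ map (G +_) (leftOpts H)
left-+ G@(⟨ xs ∣ _ ⟩) H@(⟨ ys ∣ _ ⟩) = cong₂ _++_ (addR≡map xs H) (addL≡map G ys)

right-+ : ∀ G H → rightOpts (G + H) ≡ map (_+ H) (rightOpts G) ++ map (G +_) (rightOpts H)
right-+ G@(⟨ _ ∣ xs ⟩) H@(⟨ _ ∣ ys ⟩) = cong₂ _++_ (addR≡map xs H) (addL≡map G ys)

∈left-+ˡ : ∀ G H → x ∈ leftOpts G → (x + H) ∈ leftOpts (G + H)
∈left-+ˡ G H p = subst (_ ∈_) (sym (left-+ G H)) (∈-++⁺ˡ (∈-map⁺ (_+ H) p))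

∈left-+ʳ : ∀ G H → x ∈ leftOpts H → (G + x) ∈ leftOpts (G + H)
∈left-+ʳ G H p =
  subst (_ ∈_) (sym (left-+ G H)) (∈-++⁺ʳ (map (_+ H) (leftOpts G)) (∈-map⁺ (G +_) p))

∈right-+ˡ : ∀ G H → x ∈ rightOpts G → (x + H) ∈ rightOpts (G + H)
∈right-+ˡ G H p = subst (_ ∈_) (sym (right-+ G H)) (∈-++⁺ˡ (∈-map⁺ (_+ H) p))

∈right-+ʳ : ∀ G H → x ∈ rightOpts H → (G + x) ∈ rightOpts (G + H)
∈right-+ʳ G H p =
  subst (_ ∈_) (sym (right-+ G H)) (∈-++⁺ʳ (map (_+ H) (rightOpts G)) (∈-map⁺ (G +_) p))

∈-maps⁻ : ∀ {f g : Game → Game} xs ys → y ∈ map f xs ++ map g ys →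
  (∃ λ x → x ∈ xs × y ≡ f x) ⊎ (∃ λ x → x ∈ ys × y ≡ g x)
∈-maps⁻ {f = f} {g} xs ys p with ∈-++⁻ (map f xs) p
... | inj₁ q = inj₁ (∈-map⁻ f q)
... | inj₂ q = inj₂ (∈-map⁻ g q)

∈left-+⁻ : ∀ G H → y ∈ leftOpts (G + H) →
  (∃ λ x → x ∈ leftOpts G × y ≡ x + H) ⊎ (∃ λ x → x ∈ leftOpts H × y ≡ G + x)
∈left-+⁻ G H p = ∈-maps⁻ (leftOpts G) (leftOpts H) (subst (_ ∈_) (left-+ G H) p)

∈right-+⁻ : ∀ G H → y ∈ rightOpts (G + H) →
  (∃ λ x → x ∈ rightOpts G × y ≡ x + H) ⊎ (∃ λ x → x ∈ rightOpts H × y ≡ G + x)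
∈right-+⁻ G H p = ∈-maps⁻ (rightOpts G) (rightOpts H) (subst (_ ∈_) (right-+ G H) p)

∀left-+ : ∀ {P : Game → Set} G H → (∀ {x} → x ∈ leftOpts G → P (x + H)) →
  (∀ {x} → x ∈ leftOpts H → P (G + x)) → ∀ {y} → y ∈ leftOpts (G + H) → P y
∀left-+ G H f g p with ∈left-+⁻ G H p
... | inj₁ (_ , q , refl) = f q
... | inj₂ (_ , q , refl) = g q

∀right-+ : ∀ {P : Game → Set} G H → (∀ {x} → x ∈ rightOpts G → P (x + H)) →
  (∀ {x} → x ∈ rightOpts H → P (G + x)) → ∀ {y} → y ∈ rightOpts (G + H) → P y
∀right-+ G H f g p with ∈right-+⁻ G H p
... | inj₁ (_ , q , refl) = f q
... | inj₂ (_ , q , refl) = g q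

leftEnd-+ : ∀ G H → LeftEnd G → LeftEnd H → LeftEnd (G + H)
leftEnd-+ G H e e' =
  trans (left-+ G H) (cong₂ (λ xs ys → map (_+ H) xs ++ map (G +_) ys) e e')

leftEnd-+⁻ : ∀ G H → LeftEnd (G + H) → LeftEnd G × LeftEnd H
leftEnd-+⁻ ⟨ [] ∣ _ ⟩ ⟨ [] ∣ _ ⟩ e = refl , refl
leftEnd-+⁻ ⟨ [] ∣ _ ⟩ ⟨ _ ∷ _ ∣ _ ⟩ ()
leftEnd-+⁻ ⟨ _ ∷ _ ∣ _ ⟩ ⟨ _ ∣ _ ⟩ ()

rightEnd-+ : ∀ G H → RightEnd G → RightEnd H → RightEnd (G + H)
rightEnd-+ G H e e' =
  trans (right-+ G H) (cong₂ (λ xs ys → map (_+ H) xs ++ map (G +_) ys) e e')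

rightEnd-+⁻ : ∀ G H → RightEnd (G + H) → RightEnd G × RightEnd H
rightEnd-+⁻ ⟨ _ ∣ [] ⟩ ⟨ _ ∣ [] ⟩ e = refl , refl
rightEnd-+⁻ ⟨ _ ∣ [] ⟩ ⟨ _ ∣ _ ∷ _ ⟩ ()
rightEnd-+⁻ ⟨ _ ∣ _ ∷ _ ⟩ ⟨ _ ∣ _ ⟩ ()

-- Outcomes

L≢R : {o : Outcome} → o ≡ L → ¬ (o ≡ R)
L≢R refl ()

≢R⇒L : {o : Outcome} → ¬ (o ≡ R) → o ≡ L
≢R⇒L {L} _ = refl
≢R⇒L {R} n = ⊥-elim (n refl)

≢L⇒R : {o : Outcome} → ¬ (o ≡ L) → o ≡ R
≢L⇒R {L} n = ⊥-elim (n refl)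
≢L⇒R {R} _ = refl

-- With two outcomes and `L` on top, comparing outcomes means transferring wins of Left.
≤O-intro : ∀ {o o'} → (o ≡ L → o' ≡ L) → o ≤O o'
≤O-intro {L} f rewrite f refl = L≤L
≤O-intro {R} f = R≤

≤O-elim : ∀ {o o'} → o ≤O o' → o ≡ L → o' ≡ L
≤O-elim L≤L refl = refl

maxOR-win : x ∈ xs → oR x ≡ L → maxOR xs ≡ L
maxOR-win (here refl) e rewrite e = refl
maxOR-win {xs = y ∷ _} (there p) e with oR y
... | L = refl
... | R = maxOR-win p e

maxOR-win⁻ : ∀ xs → maxOR xs ≡ L → ∃ λ x → x ∈ xs × oR x ≡ L
maxOR-win⁻ (x ∷ xs) e with oR x in eq
... | L = x , here refl , eq
... | R = let y , p , q = maxOR-win⁻ xs e in y , there p , q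

minOL-win : x ∈ xs → oL x ≡ R → minOL xs ≡ R
minOL-win (here refl) e rewrite e = refl
minOL-win {xs = y ∷ _} (there p) e with oL y
... | R = refl
... | L = minOL-win p e

minOL-win⁻ : ∀ xs → minOL xs ≡ R → ∃ λ x → x ∈ xs × oL x ≡ R
minOL-win⁻ (x ∷ xs) e with oL x in eq
... | R = x , here refl , eq
... | L = let y , p , q = minOL-win⁻ xs e in y , there p , q

oL-win : ∀ G → x ∈ leftOpts G → oR x ≡ L → oL G ≡ L
oL-win ⟨ _ ∷ _ ∣ _ ⟩ p e = maxOR-win p e

oL-end : ∀ G → LeftEnd G → oL G ≡ L
oL-end ⟨ [] ∣ _ ⟩ refl = refl

oL-win⁻ : ∀ G → oL G ≡ L → LeftEnd G ⊎ ∃ λ x → x ∈ leftOpts G × oR x ≡ L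
oL-win⁻ ⟨ [] ∣ _ ⟩ e = inj₁ refl
oL-win⁻ ⟨ xs@(_ ∷ _) ∣ _ ⟩ e = inj₂ (maxOR-win⁻ xs e)

oR-win : ∀ G → x ∈ rightOpts G → oL x ≡ R → oR G ≡ R
oR-win ⟨ _ ∣ _ ∷ _ ⟩ p e = minOL-win p e

oR-end : ∀ G → RightEnd G → oR G ≡ R
oR-end ⟨ _ ∣ [] ⟩ refl = refl

oR-win⁻ : ∀ G → oR G ≡ R → RightEnd G ⊎ ∃ λ x → x ∈ rightOpts G × oL x ≡ R
oR-win⁻ ⟨ _ ∣ [] ⟩ e = inj₁ refl
oR-win⁻ ⟨ _ ∣ xs@(_ ∷ _) ⟩ e = inj₂ (minOL-win⁻ xs e)

oL-lose : ∀ G → x ∈ leftOpts G → (∀ {y} → y ∈ leftOpts G → oR y ≡ R) → oL G ≡ R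
oL-lose G p f = ≢L⇒R λ e → case-win (oL-win⁻ G e)
  where
  case-win : ¬ (LeftEnd G ⊎ ∃ λ x → x ∈ leftOpts G × oR x ≡ L)
  case-win (inj₁ e) = ∉-[] e p
  case-win (inj₂ (_ , q , e)) = L≢R e (f q)

oR-lose : ∀ G → x ∈ rightOpts G → (∀ {y} → y ∈ rightOpts G → oL y ≡ L) → oR G ≡ L
oR-lose G p f = ≢R⇒L λ e → case-win (oR-win⁻ G e)
  where
  case-win : ¬ (RightEnd G ⊎ ∃ λ x → x ∈ rightOpts G × oL x ≡ R)
  case-win (inj₁ e) = ∉-[] e p
  case-win (inj₂ (_ , q , e)) = L≢R (f q) e

oR-lose⁻ : ∀ G → oR G ≡ L → x ∈ rightOpts G → oL x ≡ L
oR-lose⁻ G e p = ≢R⇒L λ e' → L≢R e (oR-win G p e')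

-- The order modulo dead-ending games

≥E-intro : (∀ X → DeadEnding X → (oL (H + X) ≡ L → oL (G + X) ≡ L) ×
  (oR (H + X) ≡ L → oR (G + X) ≡ L)) → G ≥E H
≥E-intro f X d = ≤O-intro (proj₁ (f X d)) , ≤O-intro (proj₂ (f X d))

≥E-trans : ∀ G H K → G ≥E H → H ≥E K → G ≥E K
≥E-trans G H K p q = ≥E-intro {K} {G} λ X d →
  ≤O-elim (proj₁ (p X d)) ∘ ≤O-elim (proj₁ (q X d)) ,
  ≤O-elim (proj₂ (p X d)) ∘ ≤O-elim (proj₂ (q X d))

≥E-oL : ∀ G H → G ≥E H → DeadEnding X → oL (H + X) ≡ L → oL (G + X) ≡ L
≥E-oL G H p d = ≤O-elim (proj₁ (p _ d))

≥E-oR : ∀ G H → G ≥E H → DeadEnding X → oR (H + X) ≡ L → oR (G + X) ≡ L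
≥E-oR G H p d = ≤O-elim (proj₂ (p _ d))

-- Ranks

∈⇒rank≤maxRank : x ∈ xs → rank x ≤ maxRank xs
∈⇒rank≤maxRank (here refl) = m≤m⊔n _ _
∈⇒rank≤maxRank (there p) = ≤-trans (∈⇒rank≤maxRank p) (m≤n⊔m _ _)

maxRank-lub : ∀ {n} xs → (∀ {x} → x ∈ xs → rank x ≤ n) → maxRank xs ≤ n
maxRank-lub [] f = z≤n
maxRank-lub (x ∷ xs) f = ⊔-lub (f (here refl)) (maxRank-lub xs (f ∘ there))

rank-left : ∀ G → x ∈ leftOpts G → rank x < rank G
rank-left ⟨ _ ∷ _ ∣ _ ⟩ p = s≤s (≤-trans (∈⇒rank≤maxRank p) (m≤m⊔n _ _))

rank-right : ∀ G → x ∈ rightOpts G → rank x < rank G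
rank-right ⟨ [] ∣ _ ∷ _ ⟩ p = s≤s (∈⇒rank≤maxRank p)
rank-right ⟨ xs@(_ ∷ _) ∣ _ ∷ _ ⟩ p =
  s≤s (≤-trans (∈⇒rank≤maxRank p) (m≤n⊔m (maxRank xs) _))

rank-lub : ∀ {n} G → (∀ {x} → x ∈ leftOpts G → rank x < n) →
  (∀ {x} → x ∈ rightOpts G → rank x < n) → rank G ≤ n
rank-lub ⟨ [] ∣ [] ⟩ f g = z≤n
rank-lub {zero} ⟨ _ ∷ _ ∣ _ ⟩ f g = contradiction (f (here refl)) λ ()
rank-lub {zero} ⟨ [] ∣ _ ∷ _ ⟩ f g = contradiction (g (here refl)) λ ()
rank-lub {suc n} ⟨ xs@(_ ∷ _) ∣ ys ⟩ f g =
  s≤s (⊔-lub (maxRank-lub xs (s≤s⁻¹ ∘ f)) (maxRank-lub ys (s≤s⁻¹ ∘ g)))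
rank-lub {suc n} ⟨ [] ∣ ys@(_ ∷ _) ⟩ f g = s≤s (maxRank-lub ys (s≤s⁻¹ ∘ g))

-- Dead-ending games

follower-trans : Follower K H → Follower H G → Follower K G
follower-trans f here = f
follower-trans f (viaL p g) = viaL p (follower-trans f g)
follower-trans f (viaR p g) = viaR p (follower-trans f g)

deadEnding-follower : DeadEnding G → Follower H G → DeadEnding H
deadEnding-follower d f K g = d K (follower-trans g f)

deadEnding-left : DeadEnding G → x ∈ leftOpts G → DeadEnding x
deadEnding-left d p = deadEnding-follower d (viaL p here)

deadEnding-right : DeadEnding G → x ∈ rightOpts G → DeadEnding x
deadEnding-right d p = deadEnding-follower d (viaR p here)

deadEnding-intro : (∀ {x} → x ∈ xs → DeadEnding x) → (∀ {y} → y ∈ ys → DeadEnding y) →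
  (xs ≡ [] → ∀ {y} → y ∈ ys → DeadLeftEnd y) →
  (ys ≡ [] → ∀ {x} → x ∈ xs → DeadRightEnd x) → DeadEnding ⟨ xs ∣ ys ⟩
deadEnding-intro f g l r H (viaL p q) = f p H q
deadEnding-intro f g l r H (viaR p q) = g p H q
deadEnding-intro f g l r _ here =
  (λ e → λ { _ here → e ; _ (viaL p q) → ⊥-elim (∉-[] e p) ; K (viaR p q) → l e p K q }) ,
  (λ e → λ { _ here → e ; _ (viaR p q) → ⊥-elim (∉-[] e p) ; K (viaL p q) → r e p K q })

deadEnding-pair : (∀ {z} → z ∈ x ∷ xs → DeadEnding z) →
  (∀ {z} → z ∈ y ∷ ys → DeadEnding z) → DeadEnding ⟨ x ∷ xs ∣ y ∷ ys ⟩
deadEnding-pair f g = deadEnding-intro f g (λ ()) (λ ())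

deadLeftEnd-intro : (∀ {y} → y ∈ ys → DeadLeftEnd y) → DeadLeftEnd ⟨ [] ∣ ys ⟩
deadLeftEnd-intro f _ here = refl
deadLeftEnd-intro f H (viaR p q) = f p H q

deadLeftEnd-right : DeadLeftEnd G → x ∈ rightOpts G → DeadLeftEnd x
deadLeftEnd-right d p H q = d H (viaR p q)

-- Every follower is a Left-end, so one that is also a Right-end has no options and is its own only
-- follower.
deadLeftEnd⇒deadEnding : DeadLeftEnd G → DeadEnding G
deadLeftEnd⇒deadEnding d H f =
  (λ _ K g → d K (follower-trans g f)) ,
  λ e → λ { _ here → e
          ; _ (viaL p _) → ⊥-elim (∉-[] (d H f) p)
          ; _ (viaR p _) → ⊥-elim (∉-[] e p) }

deadEnding⇒deadLeftEnd : DeadEnding G → LeftEnd G → DeadLeftEnd G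
deadEnding⇒deadLeftEnd d = proj₁ (d _ here)

-- Conjugation

conj-conj : ∀ G → conj (conj G) ≡ G
conjs-conjs : ∀ xs → conjs (conjs xs) ≡ xs
conj-conj ⟨ xs ∣ ys ⟩ = cong₂ ⟨_∣_⟩ (conjs-conjs xs) (conjs-conjs ys)
conjs-conjs [] = refl
conjs-conjs (x ∷ xs) = cong₂ _∷_ (conj-conj x) (conjs-conjs xs)

∈-conjs : x ∈ xs → conj x ∈ conjs xs
∈-conjs (here refl) = here refl
∈-conjs (there p) = there (∈-conjs p)

∈-conjs⁻ : x ∈ conjs xs → conj x ∈ xs
∈-conjs⁻ {xs = xs} p = subst (_ ∈_) (conjs-conjs xs) (∈-conjs p)

∈left-conj : ∀ G → x ∈ rightOpts G → conj x ∈ leftOpts (conj G)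
∈left-conj ⟨ _ ∣ _ ⟩ = ∈-conjs

∈right-conj : ∀ G → x ∈ leftOpts G → conj x ∈ rightOpts (conj G)
∈right-conj ⟨ _ ∣ _ ⟩ = ∈-conjs

∈left-conj⁻ : ∀ G → x ∈ leftOpts (conj G) → conj x ∈ rightOpts G
∈left-conj⁻ ⟨ _ ∣ _ ⟩ = ∈-conjs⁻

∈right-conj⁻ : ∀ G → x ∈ rightOpts (conj G) → conj x ∈ leftOpts G
∈right-conj⁻ ⟨ _ ∣ _ ⟩ = ∈-conjs⁻

leftEnd-conj : ∀ G → RightEnd G → LeftEnd (conj G)
leftEnd-conj ⟨ _ ∣ [] ⟩ refl = refl

rightEnd-conj : ∀ G → LeftEnd G → RightEnd (conj G)
rightEnd-conj ⟨ [] ∣ _ ⟩ refl = refl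

conj-+ : ∀ G H → conj (G + H) ≡ conj G + conj H
conjs-++ : ∀ xs ys → conjs (xs ++ ys) ≡ conjs xs ++ conjs ys
conjs-addR : ∀ xs H → conjs (addR xs H) ≡ addR (conjs xs) (conj H)
conjs-addL : ∀ G xs → conjs (addL G xs) ≡ addL (conj G) (conjs xs)
conj-+ G@(⟨ xs ∣ ys ⟩) H@(⟨ xs' ∣ ys' ⟩) = cong₂ ⟨_∣_⟩
  (trans (conjs-++ (addR ys H) (addL G ys'))
    (cong₂ _++_ (conjs-addR ys H) (conjs-addL G ys')))
  (trans (conjs-++ (addR xs H) (addL G xs'))
    (cong₂ _++_ (conjs-addR xs H) (conjs-addL G xs')))
conjs-++ [] ys = refl
conjs-++ (x ∷ xs) ys = cong (_ ∷_) (conjs-++ xs ys)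
conjs-addR [] H = refl
conjs-addR (x ∷ xs) H = cong₂ _∷_ (conj-+ x H) (conjs-addR xs H)
conjs-addL G [] = refl
conjs-addL G (x ∷ xs) = cong₂ _∷_ (conj-+ G x) (conjs-addL G xs)

flip : Outcome → Outcome
flip L = R
flip R = L

oL-conj : ∀ G → oL (conj G) ≡ flip (oR G)
oR-conj : ∀ G → oR (conj G) ≡ flip (oL G)
maxOR-conjs : ∀ xs → maxOR (conjs xs) ≡ flip (minOL xs)
minOL-conjs : ∀ xs → minOL (conjs xs) ≡ flip (maxOR xs)
oL-conj ⟨ _ ∣ [] ⟩ = refl
oL-conj ⟨ _ ∣ y ∷ ys ⟩ = maxOR-conjs (y ∷ ys)
oR-conj ⟨ [] ∣ _ ⟩ = refl
oR-conj ⟨ x ∷ xs ∣ _ ⟩ = minOL-conjs (x ∷ xs)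
maxOR-conjs [] = refl
maxOR-conjs (x ∷ xs) rewrite oR-conj x with oL x
... | L = maxOR-conjs xs
... | R = refl
minOL-conjs [] = refl
minOL-conjs (x ∷ xs) rewrite oL-conj x with oR x
... | L = refl
... | R = minOL-conjs xs

flip-≡L : ∀ {o} → flip o ≡ L → o ≡ R
flip-≡L {R} _ = refl

oL-conj-+ : ∀ G X → oL (conj G + X) ≡ flip (oR (G + conj X))
oL-conj-+ G X = trans (cong oL (trans (cong (conj G +_) (sym (conj-conj X)))
  (sym (conj-+ G (conj X))))) (oL-conj (G + conj X))

oR-conj-+ : ∀ G X → oR (conj G + X) ≡ flip (oL (G + conj X))
oR-conj-+ G X = trans (cong oR (trans (cong (conj G +_) (sym (conj-conj X)))
  (sym (conj-+ G (conj X))))) (oR-conj (G + conj X))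

follower-conj : Follower H G → Follower (conj H) (conj G)
follower-conj here = here
follower-conj {G = G} (viaL p f) = viaR (∈right-conj G p) (follower-conj f)
follower-conj {G = G} (viaR p f) = viaL (∈left-conj G p) (follower-conj f)

follower-conj⁻ : ∀ G → Follower H (conj G) → Follower (conj H) G
follower-conj⁻ G f = subst (Follower _) (conj-conj G) (follower-conj f)

leftEnd-conj⁻ : ∀ G → LeftEnd (conj G) → RightEnd G
leftEnd-conj⁻ G e = subst RightEnd (conj-conj G) (rightEnd-conj (conj G) e)

rightEnd-conj⁻ : ∀ G → RightEnd (conj G) → LeftEnd G
rightEnd-conj⁻ G e = subst LeftEnd (conj-conj G) (leftEnd-conj (conj G) e)

deadEnding-conj : DeadEnding G → DeadEnding (conj G)
deadEnding-conj {G} d H f with d (conj H) (follower-conj⁻ G f)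
... | l , r =
  (λ e K g → rightEnd-conj⁻ K (r (rightEnd-conj H e) (conj K) (follower-conj g))) ,
  (λ e K g → leftEnd-conj⁻ K (l (leftEnd-conj H e) (conj K) (follower-conj g)))

≥E-conj : ∀ G H → G ≥E H → conj H ≥E conj G
≥E-conj G H p = ≥E-intro {conj G} {conj H} λ X d →
  (λ e → trans (oL-conj-+ H X) (cong flip (≢L⇒R λ e' → L≢R
     (≥E-oR G H p (deadEnding-conj d) e')
     (flip-≡L (trans (sym (oL-conj-+ G X)) e))))) ,
  (λ e → trans (oR-conj-+ H X) (cong flip (≢L⇒R λ e' → L≢R
     (≥E-oL G H p (deadEnding-conj d) e')
     (flip-≡L (trans (sym (oR-conj-+ G X)) e)))))

≥E-conjˡ : ∀ G H → conj G ≥E H → conj H ≥E G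
≥E-conjˡ G H p = subst (conj H ≥E_) (conj-conj G) (≥E-conj (conj G) H p)

≥E-conjʳ : ∀ G H → G ≥E conj H → H ≥E conj G
≥E-conjʳ G H p = subst (_≥E conj G) (conj-conj H) (≥E-conj G (conj H) p)

-- The induction hypothesis is used at the option `conj x` of `G`, whose conjugate is the option `x`
-- of `conj G`.
rank-conj≤ : ∀ G → rank (conj G) ≤ rank G
rank-conj≤ = game-ind _ λ G f g → rank-lub (conj G)
  (λ {x} p → ≤-<-trans (subst (λ z → rank z ≤ rank (conj x)) (conj-conj x)
     (g (∈left-conj⁻ G p))) (rank-right G (∈left-conj⁻ G p)))
  (λ {x} p → ≤-<-trans (subst (λ z → rank z ≤ rank (conj x)) (conj-conj x)
     (f (∈right-conj⁻ G p))) (rank-left G (∈right-conj⁻ G p)))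

-- Contexts separating incomparable games

-- The integer -n: `n` successive moves for Right and none for Left. In misère play a large supply
-- of them favours Left.
waiting : ℕ → Game
waiting zero = 𝟎
waiting (suc n) = ⟨ [] ∣ waiting n ∷ [] ⟩

waiting-deadLeftEnd : ∀ n → DeadLeftEnd (waiting n)
waiting-deadLeftEnd zero = deadLeftEnd-intro λ ()
waiting-deadLeftEnd (suc n) = deadLeftEnd-intro λ { (here refl) → waiting-deadLeftEnd n }

waiting-deadEnding : ∀ n → DeadEnding (waiting n)
waiting-deadEnding n = deadLeftEnd⇒deadEnding (waiting-deadLeftEnd n)

WaitingWins : Game → Set
WaitingWins G = ∀ n → (rank G ≤ n → oL (G + waiting n) ≡ L) ×
  (rank G < n → oR (G + waiting n) ≡ L)

-- Left moves in `G` as long as possible. Each such move lowers the rank, and Right can spend only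
-- one move of `waiting n` in reply, so Left runs out of moves first and wins. When Right starts,
-- the strict bound pays for the additional move.
waiting-wins : ∀ G → WaitingWins G
waiting-wins = game-ind WaitingWins λ G f g n → first G f n , second G f g n
  where
  first : ∀ G → (∀ {x} → x ∈ leftOpts G → WaitingWins x) →
    ∀ n → rank G ≤ n → oL (G + waiting n) ≡ L
  first G f n le with empty-or-∈ (leftOpts G)
  ... | inj₁ e = oL-end (G + waiting n)
          (leftEnd-+ G (waiting n) e (waiting-deadLeftEnd n _ here))
  ... | inj₂ (x , p) = oL-win (G + waiting n) (∈left-+ˡ G (waiting n) p)
          (proj₂ (f p n) (<-≤-trans (rank-left G p) le))
  second : ∀ G → (∀ {x} → x ∈ leftOpts G → WaitingWins x) →
    (∀ {x} → x ∈ rightOpts G → WaitingWins x) →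
    ∀ n → rank G < n → oR (G + waiting n) ≡ L
  second G f g (suc n) lt = oR-lose (G + waiting (suc n))
    (∈right-+ʳ G (waiting (suc n)) (here refl))
    (∀right-+ G (waiting (suc n))
      (λ p → proj₁ (g p (suc n)) (<⇒≤ (<-≤-trans (rank-right G p) (<⇒≤ lt))))
      λ { (here refl) → first G f n (s≤s⁻¹ lt) })

waiting-winsᶜ : ∀ G n → rank G < n → oL (G + conj (waiting n)) ≡ R
waiting-winsᶜ G n lt = flip-≡L (trans (sym (oR-conj-+ G (waiting n)))
  (proj₂ (waiting-wins (conj G) n) (≤-<-trans (rank-conj≤ G) lt)))

waiting-winsᶜ′ : ∀ G n → rank G ≤ n → oR (G + conj (waiting n)) ≡ R
waiting-winsᶜ′ G n le = flip-≡L (trans (sym (oL-conj-+ G (waiting n)))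
  (proj₁ (waiting-wins (conj G) n) (≤-trans (rank-conj≤ G) le)))

separate : ∀ G H → ¬ (G ≥E H) → ¬ ¬ ∃ λ X → DeadEnding X ×
  ((oL (G + X) ≡ R × oL (H + X) ≡ L) ⊎ (oR (G + X) ≡ R × oR (H + X) ≡ L))
separate G H n k = n (≥E-intro {H} {G} λ X d →
  (λ e → ≢R⇒L λ e' → k (X , d , inj₁ (e' , e))) ,
  (λ e → ≢R⇒L λ e' → k (X , d , inj₂ (e' , e))))

-- If the separation has Left to move, one move of Right from `T` to `X` reaches it. Should Right
-- move inside `H` instead, Left answers by turning `T` into `waiting (rank H)` and wins.
separateR : ∀ G H → ¬ (G ≥E H) →
  ¬ ¬ ∃ λ X → oR (H + X) ≡ L × oR (G + X) ≡ R × DeadEnding X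
separateR G H n = do
  X , d , inj₁ (e , e') ← separate G H n
    where X , d , inj₂ (e , e') → pure (X , e' , e , d)
  let T = ⟨ waiting (rank H) ∷ [] ∣ X ∷ [] ⟩
  pure (T
    , oR-lose (H + T) (∈right-+ʳ H T (here refl)) (∀right-+ H T
        (λ {x} p → oL-win (x + T) (∈left-+ʳ x T (here refl))
          (proj₂ (waiting-wins x (rank H)) (rank-right H p)))
        λ { (here refl) → e' })
    , oR-win (G + T) (∈right-+ʳ G T (here refl)) e
    , deadEnding-pair (λ { (here refl) → waiting-deadEnding (rank H) ; (there ()) })
        (λ { (here refl) → d ; (there ()) }))

-- The mirror image: Left reaches `X` in one move, and a move of Left inside `G` is answered by
-- Right's move to `w`.
separateL : ∀ G H → ¬ (G ≥E H) →
  ¬ ¬ ∃ λ X → oL (G + X) ≡ R × DeadEnding X × oL (H + X) ≡ L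
separateL G H n = do
  X , d , inj₂ (e , e') ← separate G H n
    where X , d , inj₁ (e , e') → pure (X , e , d , e')
  let w = conj (waiting (rank G))
      T = ⟨ X ∷ [] ∣ w ∷ [] ⟩
  pure (T
    , oL-lose (G + T) (∈left-+ʳ G T (here refl)) (∀left-+ G T
        (λ {x} p → oR-win (x + T) (∈right-+ʳ x T (here refl))
          (waiting-winsᶜ x (rank G) (rank-left G p)))
        λ { (here refl) → e })
    , deadEnding-pair (λ { (here refl) → d ; (there ()) })
        (λ { (here refl) → deadEnding-conj (waiting-deadEnding (rank G)) ; (there ()) })
    , oL-win (H + T) (∈left-+ʳ H T (here refl)) e')

-- Otherwise every Left option g of G is separated from h by some X, and every Right option
-- k of h from G by some Y; then {Ys | Xs} separates G from H. The extra waiting games only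
-- make its two option sets nonempty.
≥E-left : ∀ G H {h} → G ≥E H → h ∈ leftOpts H →
  ¬ ¬ ((∃ λ g → g ∈ leftOpts G × g ≥E h) ⊎ (∃ λ k → k ∈ rightOpts h × G ≥E k))
≥E-left G H {h} ge h∈ none = absurd do
  Xs , Xs-reply , Xs-safe ← choose {λ g X → oL (g + X) ≡ R} {λ X → DeadEnding X × oL (h + X) ≡ L}
    (leftOpts G) (λ {g} p → separateL g h λ ge' → none (inj₁ (g , p , ge')))
  Ys , Ys-reply , Ys-safe ← choose {λ k Y → oR (k + Y) ≡ L} {λ Y → oR (G + Y) ≡ R × DeadEnding Y}
    (rightOpts h) (λ {k} p → separateR G k λ ge' → none (inj₂ (k , p , ge')))
  let w = waiting (rank h)
      v = conj (waiting (rank G))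
      T = ⟨ v ∷ Ys ∣ w ∷ Xs ⟩
      T-deadEnding : DeadEnding T
      T-deadEnding = deadEnding-pair
        (λ { (here refl) → deadEnding-conj (waiting-deadEnding (rank G))
           ; (there p) → proj₂ (Ys-safe p) })
        (λ { (here refl) → waiting-deadEnding (rank h) ; (there p) → proj₁ (Xs-safe p) })
      G+T : oL (G + T) ≡ R
      G+T = oL-lose (G + T) (∈left-+ʳ G T (here refl)) (∀left-+ G T
        (λ {g} p → let X , X∈ , e = Xs-reply p in
          oR-win (g + T) (∈right-+ʳ g T (there X∈)) e)
        λ { (here refl) → waiting-winsᶜ′ G (rank G) ≤-refl
          ; (there p) → proj₁ (Ys-safe p) })
      H+T : oL (H + T) ≡ L
      H+T = oL-win (H + T) (∈left-+ˡ H T h∈)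
        (oR-lose (h + T) (∈right-+ʳ h T (here refl)) (∀right-+ h T
          (λ {k} p → let Y , Y∈ , e = Ys-reply p in
            oL-win (k + T) (∈left-+ʳ k T (there Y∈)) e)
          λ { (here refl) → proj₁ (waiting-wins h (rank h)) ≤-refl
            ; (there p) → proj₂ (Xs-safe p) }))
  pure (L≢R (≥E-oL G H ge T-deadEnding H+T) G+T)

≥E-right : ∀ G H {g} → G ≥E H → g ∈ rightOpts G →
  ¬ ¬ ((∃ λ h → h ∈ rightOpts H × g ≥E h) ⊎ (∃ λ k → k ∈ leftOpts g × k ≥E H))
≥E-right G H {g} ge g∈ = do
  inj₁ (h , p , h≥g) ← ≥E-left (conj H) (conj G) (≥E-conj G H ge) (∈left-conj G g∈)
    where inj₂ (k , p , H≥k) → pure (inj₂ (conj k , ∈right-conj⁻ g p , ≥E-conjˡ H k H≥k))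
  pure (inj₁ (conj h , ∈left-conj⁻ H p , ≥E-conjʳ h g h≥g))

-- Identity of games

_⊆I_ : List Game → List Game → Set
xs ⊆I ys = ∀ {x} → x ∈ xs → ∃ λ y → y ∈ ys × x ≅ y

anyI-elim : ∀ x ys → anyI x ys ≡ true → ∃ λ y → y ∈ ys × x ≅ y
anyI-elim x (y ∷ ys) e with ident x y in eq
... | true = y , here refl , eq
... | false = let z , p , q = anyI-elim x ys e in z , there p , q

anyI-intro : ∀ x → y ∈ ys → x ≅ y → anyI x ys ≡ true
anyI-intro x (here refl) e rewrite e = refl
anyI-intro {ys = z ∷ _} x (there p) e with ident x z
... | true = refl
... | false = anyI-intro x p e

subI-elim : ∀ xs ys → subI xs ys ≡ true → xs ⊆I ys
subI-elim (x ∷ xs) ys e (here refl) =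
  anyI-elim x ys (∧-conicalˡ (anyI x ys) (subI xs ys) e)
subI-elim (x ∷ xs) ys e (there p) =
  subI-elim xs ys (∧-conicalʳ (anyI x ys) (subI xs ys) e) p

subI-intro : ∀ xs ys → xs ⊆I ys → subI xs ys ≡ true
subI-intro [] ys f = refl
subI-intro (x ∷ xs) ys f = let y , p , e = f (here refl) in
  cong₂ _∧_ (anyI-intro x p e) (subI-intro xs ys (f ∘ there))

SameOptions : Game → Game → Set
SameOptions G H = leftOpts G ⊆I leftOpts H × leftOpts H ⊆I leftOpts G ×
  rightOpts G ⊆I rightOpts H × rightOpts H ⊆I rightOpts G

≅-elim : ∀ G H → G ≅ H → SameOptions G H
≅-elim ⟨ xs ∣ ys ⟩ ⟨ xs' ∣ ys' ⟩ e =
  subI-elim xs xs' (∧-conicalˡ (subI xs xs') _ e) ,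
  subI-elim xs' xs (∧-conicalˡ (subI xs' xs) _ e₁) ,
  subI-elim ys ys' (∧-conicalˡ (subI ys ys') _ e₂) ,
  subI-elim ys' ys (∧-conicalʳ (subI ys ys') _ e₂)
  where
  e₁ = ∧-conicalʳ (subI xs xs') _ e
  e₂ = ∧-conicalʳ (subI xs' xs) _ e₁

≅-intro : ∀ G H → SameOptions G H → G ≅ H
≅-intro ⟨ xs ∣ ys ⟩ ⟨ xs' ∣ ys' ⟩ (a , b , c , d) =
  cong₂ _∧_ (subI-intro xs xs' a) (cong₂ _∧_ (subI-intro xs' xs b)
    (cong₂ _∧_ (subI-intro ys ys' c) (subI-intro ys' ys d)))

≅-stable : ∀ G H → ¬ ¬ (G ≅ H) → G ≅ H
≅-stable G H = decidable-stable (ident G H ≟ true)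

≅-sym : ∀ G H → G ≅ H → H ≅ G
≅-sym G H e = let a , b , c , d = ≅-elim G H e in ≅-intro H G (b , a , d , c)

≅-trans : ∀ G H K → G ≅ H → H ≅ K → G ≅ K
≅-trans = game-ind _ λ G f g H K G≅H H≅K →
  let a , b , c , d = ≅-elim G H G≅H
      a' , b' , c' , d' = ≅-elim H K H≅K
  in ≅-intro G K
    ( (λ p → let y , q , e = a p ; z , r , e' = a' q in z , r , f p y z e e')
    , (λ {z} p → let y , q , e = b' p ; x , r , e' = b q in
        x , r , ≅-sym x z (f r y z (≅-sym y x e') (≅-sym z y e)))
    , (λ p → let y , q , e = c p ; z , r , e' = c' q in z , r , g p y z e e')
    , (λ {z} p → let y , q , e = d' p ; x , r , e' = d q in
        x , r , ≅-sym x z (g r y z (≅-sym y x e') (≅-sym z y e))))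

≅⇒rank≤ : ∀ G H → G ≅ H → rank G ≤ rank H
≅⇒rank≤ = game-ind _ λ G f g H G≅H →
  let a , b , c , d = ≅-elim G H G≅H in
  rank-lub G
    (λ p → let y , q , e = a p in ≤-<-trans (f p y e) (rank-left H q))
    (λ p → let y , q , e = c p in ≤-<-trans (g p y e) (rank-right H q))

-- The backward matching serves the case in which `G` has no Left option, a win for Left: it makes
-- `H` a Left-end as well.
oL-mono : ∀ G H → (∀ {x} → x ∈ leftOpts G → ∃ λ y → y ∈ leftOpts H × oR x ≡ oR y) →
  (∀ {y} → y ∈ leftOpts H → ∃ λ x → x ∈ leftOpts G × oR x ≡ oR y) →
  oL G ≡ L → oL H ≡ L
oL-mono G H f g e with oL-win⁻ G e
... | inj₂ (x , p , e') = let y , q , e'' = f p in oL-win H q (trans (sym e'') e')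
... | inj₁ end with empty-or-∈ (leftOpts H)
... | inj₁ end' = oL-end H end'
... | inj₂ (_ , q) = let _ , p , _ = g q in ⊥-elim (∉-[] end p)

oR-mono : ∀ G H → (∀ {x} → x ∈ rightOpts G → ∃ λ y → y ∈ rightOpts H × oL x ≡ oL y) →
  (∀ {y} → y ∈ rightOpts H → ∃ λ x → x ∈ rightOpts G × oL x ≡ oL y) →
  oR G ≡ R → oR H ≡ R
oR-mono G H f g e with oR-win⁻ G e
... | inj₂ (x , p , e') = let y , q , e'' = f p in oR-win H q (trans (sym e'') e')
... | inj₁ end with empty-or-∈ (rightOpts H)
... | inj₁ end' = oR-end H end'
... | inj₂ (_ , q) = let _ , p , _ = g q in ⊥-elim (∉-[] end p)

oL-cong : ∀ G H → (∀ {x} → x ∈ leftOpts G → ∃ λ y → y ∈ leftOpts H × oR x ≡ oR y) →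
  (∀ {y} → y ∈ leftOpts H → ∃ λ x → x ∈ leftOpts G × oR x ≡ oR y) → oL G ≡ oL H
oL-cong G H f g with oL G in eG
... | L = sym (oL-mono G H f g eG)
... | R = sym (≢L⇒R λ e → L≢R (oL-mono H G
    (λ p → let x , q , e' = g p in x , q , sym e')
    (λ p → let x , q , e' = f p in x , q , sym e') e) eG)

oR-cong : ∀ G H → (∀ {x} → x ∈ rightOpts G → ∃ λ y → y ∈ rightOpts H × oL x ≡ oL y) →
  (∀ {y} → y ∈ rightOpts H → ∃ λ x → x ∈ rightOpts G × oL x ≡ oL y) → oR G ≡ oR H
oR-cong G H f g with oR G in eG
... | R = sym (oR-mono G H f g eG)
... | L = sym (≢R⇒L λ e → L≢R eG (oR-mono H G
    (λ p → let x , q , e' = g p in x , q , sym e')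
    (λ p → let x , q , e' = f p in x , q , sym e') e))

SameOutcome : Game → Game → Set
SameOutcome G H = oL G ≡ oL H × oR G ≡ oR H

-- The outer induction on `G` handles moves in `G` and `H`, the inner one on `X` handles moves in
-- the context.
≅⇒sameOutcome : ∀ G H → G ≅ H → ∀ X → SameOutcome (G + X) (H + X)
≅⇒sameOutcome = game-ind _ λ G f g H G≅H →
  let a , b , c , d = ≅-elim G H G≅H in
  game-ind _ λ X f' g' →
    oL-cong (G + X) (H + X)
      (∀left-+ G X
        (λ p → let y , q , e = a p in y + X , ∈left-+ˡ H X q , proj₂ (f p y e X))
        (λ {x} p → H + x , ∈left-+ʳ H X p , proj₂ (f' p)))
      (∀left-+ H X
        (λ {y} p → let x , q , e = b p in
          x + X , ∈left-+ˡ G X q , proj₂ (f q y (≅-sym y x e) X))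
        (λ {x} p → G + x , ∈left-+ʳ G X p , proj₂ (f' p))) ,
    oR-cong (G + X) (H + X)
      (∀right-+ G X
        (λ p → let y , q , e = c p in y + X , ∈right-+ˡ H X q , proj₁ (g p y e X))
        (λ {x} p → H + x , ∈right-+ʳ H X p , proj₁ (g' p)))
      (∀right-+ H X
        (λ {y} p → let x , q , e = d p in
          x + X , ∈right-+ˡ G X q , proj₁ (g q y (≅-sym y x e) X))
        (λ {x} p → G + x , ∈right-+ʳ G X p , proj₁ (g' p)))

≅⇒≥E : ∀ G H → G ≅ H → G ≥E H
≅⇒≥E G H e = ≥E-intro {H} {G} λ X _ →
  trans (proj₁ (≅⇒sameOutcome G H e X)) , trans (proj₂ (≅⇒sameOutcome G H e X))

∈-removeI : ∀ A → x ∈ xs → ¬ (x ≅ A) → x ∈ removeI A xs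
∈-removeI {x = x} A (here refl) n with ident x A
... | true = contradiction refl n
... | false = here refl
∈-removeI {xs = y ∷ _} A (there p) n with ident y A
... | true = ∈-removeI A p n
... | false = there (∈-removeI A p n)

∈-removeI⁻ : ∀ A xs → x ∈ removeI A xs → x ∈ xs × ¬ (x ≅ A)
∈-removeI⁻ A (y ∷ ys) p with ident y A in eq
∈-removeI⁻ A (y ∷ ys) p | true = let q , n = ∈-removeI⁻ A ys p in there q , n
∈-removeI⁻ A (y ∷ ys) (here refl) | false =
  here refl , λ e → contradiction (trans (sym e) eq) λ ()
∈-removeI⁻ A (y ∷ ys) (there p) | false = let q , n = ∈-removeI⁻ A ys p in there q , n

removeI-all : ∀ A xs → (∀ {x} → x ∈ xs → x ≅ A) → removeI A xs ≡ []
removeI-all A xs f with empty-or-∈ (removeI A xs)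
... | inj₁ e = e
... | inj₂ (_ , p) = let q , n = ∈-removeI⁻ A xs p in ⊥-elim (n (f q))

-- Perfect murders

M-leftEnd : ∀ n → LeftEnd (M n)
M-leftEnd zero = refl
M-leftEnd (suc n) = refl

rank-M≤ : ∀ n → rank (M n) ≤ n
rank-M≤ zero = z≤n
rank-M≤ (suc n) = s≤s (⊔-lub z≤n (⊔-lub (rank-M≤ n) z≤n))

-- `B` and `n` stay general because a Right move in `B` changes both while leaving `X` fixed; the
-- induction is on `X` alone.
MBelow : Game → Set
MBelow X = ∀ B n → DeadLeftEnd B → rank B ≤ n → (RightEnd B → n ≡ 0) →
  (oL (M n + X) ≡ L → oL (B + X) ≡ L) × (oR (M n + X) ≡ L → oR (B + X) ≡ L)

-- M n is not below 𝟎 for n > 0, whence the last hypothesis.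
M≤deadLeftEnd : ∀ B n → DeadLeftEnd B → rank B ≤ n → (RightEnd B → n ≡ 0) → B ≥E M n
M≤deadLeftEnd B n d le z = ≥E-intro {M n} {B} λ X _ → below X B n d le z
  where
  oL-below : ∀ X → (∀ {x} → x ∈ leftOpts X → MBelow x) → ∀ B n → DeadLeftEnd B →
    rank B ≤ n → (RightEnd B → n ≡ 0) → oL (M n + X) ≡ L → oL (B + X) ≡ L
  oL-below X f B n d le z e with oL-win⁻ (M n + X) e
  ... | inj₁ end = oL-end (B + X)
          (leftEnd-+ B X (d B here) (proj₂ (leftEnd-+⁻ (M n) X end)))
  ... | inj₂ (y , p , e') with ∈left-+⁻ (M n) X p
  ... | inj₁ (_ , q , _) = ⊥-elim (∉-[] (M-leftEnd n) q)
  ... | inj₂ (x , q , refl) =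
          oL-win (B + X) (∈left-+ʳ B X q) (proj₂ (f q B n d le z) e')
  -- After Right's move to `b`, the game to compare with is an option of `M (suc n)`: `𝟎` if `b` has
  -- no moves, and otherwise `M n`.
  oL-right : ∀ X → (∀ {x} → x ∈ leftOpts X → MBelow x) → ∀ n {b} → DeadLeftEnd b →
    rank b < n → oR (M n + X) ≡ L → oL (b + X) ≡ L
  oL-right X f (suc n) {b} d lt e with empty-or-∈ (rightOpts b)
  ... | inj₁ end = oL-below X f b 0 d
          (rank-lub b (λ p → ⊥-elim (∉-[] (d b here) p)) (λ p → ⊥-elim (∉-[] end p)))
          (λ _ → refl)
          (oR-lose⁻ (M (suc n) + X) e (∈right-+ˡ (M (suc n)) X (here refl)))
  ... | inj₂ (_ , p) = oL-below X f b n d (s≤s⁻¹ lt) (λ end → ⊥-elim (∉-[] end p))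
          (oR-lose⁻ (M (suc n) + X) e (∈right-+ˡ (M (suc n)) X (there (here refl))))
  oR-below : ∀ X → (∀ {x} → x ∈ leftOpts X → MBelow x) →
    (∀ {x} → x ∈ rightOpts X → MBelow x) → ∀ B n → DeadLeftEnd B →
    rank B ≤ n → (RightEnd B → n ≡ 0) → oR (M n + X) ≡ L → oR (B + X) ≡ L
  oR-below X f g B n d le z e = ≢R⇒L λ e' → right-loses (oR-win⁻ (B + X) e')
    where
    right-loses : ¬ (RightEnd (B + X) ⊎ ∃ λ x → x ∈ rightOpts (B + X) × oL x ≡ R)
    right-loses (inj₁ end) with rightEnd-+⁻ B X end
    -- Here `n` must be `0`, so `M n + X` would be a Right-end too, and Right would win it.
    ... | endB , endX with z endB
    ... | refl = L≢R e (oR-end (𝟎 + X) (rightEnd-+ 𝟎 X refl endX))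
    right-loses (inj₂ (_ , p , e')) = L≢R (∀right-+ {P = λ y → oL y ≡ L} B X
      (λ q → oL-right X f n (deadLeftEnd-right d q) (<-≤-trans (rank-right B q) le) e)
      (λ q → proj₁ (g q B n d le z) (oR-lose⁻ (M n + X) e (∈right-+ʳ (M n) X q))) p) e'
  below : ∀ X → MBelow X
  below = game-ind MBelow λ X f g B n d le z →
    oL-below X f B n d le z , oR-below X f g B n d le z

rightEnd⇒rank≡0 : DeadLeftEnd G → RightEnd G → rank G ≡ 0
rightEnd⇒rank≡0 {⟨ [] ∣ [] ⟩} d e = refl
rightEnd⇒rank≡0 {⟨ _ ∷ _ ∣ [] ⟩} d e = contradiction (d _ here) λ ()

deadLeftEnd≥M : ∀ B → DeadLeftEnd B → B ≥E M (rank B)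
deadLeftEnd≥M B d = M≤deadLeftEnd B (rank B) d ≤-refl (rightEnd⇒rank≡0 d)

-- Duality of reducedness

∧-swap : ∀ a b c d → a ∧ b ∧ c ∧ d ≡ c ∧ d ∧ a ∧ b
∧-swap a b c d = begin
  a ∧ b ∧ c ∧ d    ≡⟨ ∧-assoc a b (c ∧ d) ⟨
  (a ∧ b) ∧ c ∧ d  ≡⟨ ∧-comm (a ∧ b) (c ∧ d) ⟩
  (c ∧ d) ∧ a ∧ b  ≡⟨ ∧-assoc c d (a ∧ b) ⟩
  c ∧ d ∧ a ∧ b    ∎
  where open ≡-Reasoning

ident-conj : ∀ G H → ident (conj G) (conj H) ≡ ident G H
subI-conjs : ∀ xs ys → subI (conjs xs) (conjs ys) ≡ subI xs ys
anyI-conjs : ∀ x ys → anyI (conj x) (conjs ys) ≡ anyI x ys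
ident-conj ⟨ xs ∣ ys ⟩ ⟨ xs' ∣ ys' ⟩ =
  trans (cong₂ _∧_ (subI-conjs ys ys') (cong₂ _∧_ (subI-conjs ys' ys)
          (cong₂ _∧_ (subI-conjs xs xs') (subI-conjs xs' xs))))
    (∧-swap (subI ys ys') (subI ys' ys) (subI xs xs') (subI xs' xs))
subI-conjs [] ys = refl
subI-conjs (x ∷ xs) ys = cong₂ _∧_ (anyI-conjs x ys) (subI-conjs xs ys)
anyI-conjs x [] = refl
anyI-conjs x (y ∷ ys) = cong₂ _∨_ (ident-conj x y) (anyI-conjs x ys)

≅-conj : ∀ G H → G ≅ H → conj G ≅ conj H
≅-conj G H = trans (ident-conj G H)

≅-conj⁻ : ∀ G H → conj G ≅ conj H → G ≅ H
≅-conj⁻ G H = trans (sym (ident-conj G H))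

removeI-conjs : ∀ A xs → removeI (conj A) (conjs xs) ≡ conjs (removeI A xs)
removeI-conjs A [] = refl
removeI-conjs A (x ∷ xs) rewrite ident-conj x A with ident x A
... | true = removeI-conjs A xs
... | false = cong (conj x ∷_) (removeI-conjs A xs)

delL-conj : ∀ K A → delL (conj K) A ≡ conj (delR K (conj A))
delL-conj ⟨ _ ∣ ys ⟩ A = cong ⟨_∣ _ ⟩
  (trans (cong (λ B → removeI B (conjs ys)) (sym (conj-conj A))) (removeI-conjs (conj A) ys))

delR-conj : ∀ K A → delR (conj K) A ≡ conj (delL K (conj A))
delR-conj ⟨ xs ∣ _ ⟩ A = cong ⟨ _ ∣_⟩
  (trans (cong (λ B → removeI B (conjs xs)) (sym (conj-conj A))) (removeI-conjs (conj A) xs))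

deadEnding-conj⁻ : ∀ G → DeadEnding (conj G) → DeadEnding G
deadEnding-conj⁻ G d = subst DeadEnding (conj-conj G) (deadEnding-conj d)

LFundamental-conj : ∀ K A → RFundamental K (conj A) → LFundamental (conj K) A
LFundamental-conj K A (w , Y , d , e , l) =
  (λ X d e → trans (oL-conj-+ K X)
    (cong flip (w (conj X) (deadEnding-conj d) (rightEnd-conj X e)))) ,
  conj Y , deadEnding-conj d , leftEnd-conj Y e ,
  trans (cong oL (trans (cong (_+ conj Y) (delL-conj K A)) (sym (conj-+ (delR K (conj A)) Y))))
    (trans (oL-conj (delR K (conj A) + Y)) (cong flip l))

RFundamental-conj : ∀ K A → LFundamental K (conj A) → RFundamental (conj K) A
RFundamental-conj K A (w , Y , d , e , l) =
  (λ X d e → trans (oR-conj-+ K X)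
    (cong flip (w (conj X) (deadEnding-conj d) (leftEnd-conj X e)))) ,
  conj Y , deadEnding-conj d , rightEnd-conj Y e ,
  trans (cong oR (trans (cong (_+ conj Y) (delR-conj K A)) (sym (conj-+ (delL K (conj A)) Y))))
    (trans (oR-conj (delL K (conj A) + Y)) (cong flip l))

LEndRev-conj : ∀ K A → LEndRev (conj K) A → REndRev K (conj A)
LEndRev-conj K A (B , p , e , le) =
  conj B , ∈left-conj A p , rightEnd-conj B e , ≥E-conjˡ K B le

REndRev-conj : ∀ K A → REndRev (conj K) A → LEndRev K (conj A)
REndRev-conj K A (B , p , e , le) =
  conj B , ∈right-conj A p , leftEnd-conj B e , ≥E-conjʳ B K le

R1-conj : ∀ K → R1 (conj K) → R1 K
R1-conj K (inj₁ (A , B , p , q , n , le)) =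
  inj₂ (conj A , conj B , ∈left-conj⁻ K p , ∈left-conj⁻ K q , n ∘ ≅-conj⁻ A B , ≥E-conj B A le)
R1-conj K (inj₂ (A , B , p , q , n , le)) =
  inj₁ (conj A , conj B , ∈right-conj⁻ K p , ∈right-conj⁻ K q , n ∘ ≅-conj⁻ A B , ≥E-conj A B le)

R2-conj : ∀ K → R2 (conj K) → R2 K
R2-conj K (inj₁ (A , p , B , q , le , B' , q')) =
  inj₂ (conj A , ∈left-conj⁻ K p , conj B , ∈left-conj A q , ≥E-conjˡ K B le ,
    conj B' , ∈right-conj B q')
R2-conj K (inj₂ (A , p , B , q , le , B' , q')) =
  inj₁ (conj A , ∈right-conj⁻ K p , conj B , ∈right-conj A q , ≥E-conjʳ B K le ,
    conj B' , ∈left-conj B q')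

R3-conj : ∀ K → R3 (conj K) → R3 K
R3-conj K (inj₁ (A , p , r , n , d)) =
  inj₂ (conj A , ∈left-conj⁻ K p , LEndRev-conj K A r , n ∘ LFundamental-conj K A ,
    deadEnding-conj⁻ (delR K (conj A)) (subst DeadEnding (delL-conj K A) d))
R3-conj K (inj₂ (A , p , r , n , d)) =
  inj₁ (conj A , ∈right-conj⁻ K p , REndRev-conj K A r , n ∘ RFundamental-conj K A ,
    deadEnding-conj⁻ (delL K (conj A)) (subst DeadEnding (delR-conj K A) d))

isSingleton-conjs : ∀ xs A → IsSingleton (conjs xs) A → IsSingleton xs (conj A)
isSingleton-conjs xs A (p , f) =
  ∈-conjs⁻ p , λ x q → subst (_≅ conj A) (conj-conj x) (≅-conj (conj x) A (f (conj x) (∈-conjs q)))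

R4-conj : ∀ K → R4 (conj K) → R4 K
R4-conj K@(⟨ xs ∣ ys ⟩) (A , C , sA , sC , rA , rC) =
  conj C , conj A , isSingleton-conjs xs C sC , isSingleton-conjs ys A sA ,
  REndRev-conj K C rC , LEndRev-conj K A rA

R5-conj : ∀ K → R5 (conj K) → R5 K
R5-conj K (inj₁ (A , p , r , n , (le , least) , neq)) =
  inj₂ (conj A , ∈left-conj⁻ K p , LEndRev-conj K A r , n ,
    (≥E-conjˡ K (M n) le , λ m lt le' → least m lt (subst (conj K ≥E_) (conj-conj (M m))
      (≥E-conj (conj (M m)) K le'))) ,
    λ e → neq (≅-conj⁻ A ⟨ [] ∣ M n ∷ [] ⟩ e))
R5-conj K (inj₂ (A , p , r , n , (le , least) , neq)) =
  inj₁ (conj A , ∈right-conj⁻ K p , REndRev-conj K A r , n ,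
    (subst (K ≥E_) (conj-conj (M n)) (≥E-conjʳ (conj (M n)) K le) ,
     λ m lt le' → least m lt (≥E-conj K (M m) le')) ,
    λ e → neq (trans (sym (ident-conj A ⟨ conj (M n) ∷ [] ∣ [] ⟩))
      (subst (λ z → conj A ≅ ⟨ [] ∣ z ∷ [] ⟩) (sym (conj-conj (M n))) e)))

locallyReduced-conj : ∀ K → LocallyReduced K → LocallyReduced (conj K)
locallyReduced-conj K (d , n) = deadEnding-conj d , λ where
  (inj₁ r) → n (inj₁ (R1-conj K r))
  (inj₂ (inj₁ r)) → n (inj₂ (inj₁ (R2-conj K r)))
  (inj₂ (inj₂ (inj₁ r))) → n (inj₂ (inj₂ (inj₁ (R3-conj K r))))
  (inj₂ (inj₂ (inj₂ (inj₁ r)))) → n (inj₂ (inj₂ (inj₂ (inj₁ (R4-conj K r)))))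
  (inj₂ (inj₂ (inj₂ (inj₂ r)))) → n (inj₂ (inj₂ (inj₂ (inj₂ (R5-conj K r)))))

reduced-conj : ∀ G → Reduced G → Reduced (conj G)
reduced-conj G (d , r) = deadEnding-conj d , λ H f →
  subst LocallyReduced (conj-conj H) (locallyReduced-conj (conj H) (r (conj H) (follower-conj⁻ G f)))

reduced-follower : Reduced G → Follower H G → Reduced H
reduced-follower (d , r) f = deadEnding-follower d f , λ K g → r K (follower-trans g f)

-- Options of locally reduced games

left-dominated : ∀ K A B → LocallyReduced K → A ∈ leftOpts K → B ∈ leftOpts K →
  B ≥E A → A ≅ B
left-dominated K A B (_ , n) p q le =
  ≅-stable A B λ neq → n (inj₁ (inj₁ (A , B , p , q , neq , le)))

-- Reversibility through an arbitrary Right option. In a locally reduced game (R2) excludes the open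
-- case, so it amounts to end-reversibility.
LReversible : Game → Game → Set
LReversible K A = ∃ λ B → B ∈ rightOpts A × B ≤E K

reversible⇒LEndRev : ∀ K A → LocallyReduced K → A ∈ leftOpts K → LReversible K A → LEndRev K A
reversible⇒LEndRev K A (_ , n) p (B , q , le) with empty-or-∈ (leftOpts B)
... | inj₁ e = B , q , e , le
... | inj₂ (B' , q') = contradiction (inj₂ (inj₁ (inj₁ (A , p , B , q , le , B' , q')))) n

-- As `≥E` is not decided, the least index exists only under double negation: either no smaller
-- index works or the search restarts at one. The bound `b` makes the recursion structural.
leastAboveM : ∀ K n → K ≥E M n → ¬ ¬ ∃ λ m → LeastAboveM K m
leastAboveM K n = go n n ≤-refl
  where
  go : ∀ b n → n ≤ b → K ≥E M n → ¬ ¬ ∃ λ m → LeastAboveM K m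
  go b n n≤b le k = k (n , le , smaller b n≤b)
    where
    smaller : ∀ b → n ≤ b → ∀ m → m < n → ¬ (K ≥E M m)
    smaller zero n≤0 m lt _ = contradiction (<-≤-trans lt n≤0) λ ()
    smaller (suc b) n≤1+b m lt le' = go b m (s≤s⁻¹ (≤-trans lt n≤1+b)) le' k

-- The reversing Left-end `B` is dead, so `K ≥E B` and `B ≥E M (rank B)`. Hence a least index
-- exists, and (R5) then determines `A`.
reversible-murder : ∀ K A → LocallyReduced K → A ∈ leftOpts K → LReversible K A →
  ¬ ¬ ∃ λ n → LeastAboveM K n × A ≅ ⟨ [] ∣ M n ∷ [] ⟩
reversible-murder K A lr@(d , n) p rev = do
  let r@(B , q , e , le) = reversible⇒LEndRev K A lr p rev
      B-dead = deadEnding⇒deadLeftEnd (deadEnding-right (deadEnding-left d p) q) e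
  m , least ← leastAboveM K (rank B) (≥E-trans K B (M (rank B)) le (deadLeftEnd≥M B B-dead))
  pure (m , least , ≅-stable A ⟨ [] ∣ M m ∷ [] ⟩ λ neq →
    n (inj₂ (inj₂ (inj₂ (inj₂ (inj₁ (A , p , r , m , least , neq)))))))

least-unique : ∀ K m n → LeastAboveM K m → LeastAboveM K n → m ≡ n
least-unique K m n (le , f) (le' , g) =
  ≤-antisym (≮⇒≥ λ lt → f n lt le') (≮⇒≥ λ lt → g m lt le)

-- The index given by `reversible-murder` depends on `K` alone.
left-reversible-unique : ∀ K A B → LocallyReduced K → A ∈ leftOpts K → B ∈ leftOpts K →
  LReversible K A → LReversible K B → A ≅ B
left-reversible-unique K A B lr p q r s = ≅-stable A B do
  m , least , eA ← reversible-murder K A lr p r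
  n , least' , eB ← reversible-murder K B lr q s
  let eA' = subst (λ n → A ≅ ⟨ [] ∣ M n ∷ [] ⟩) (least-unique K m n least least') eA
  pure (≅-trans A _ B eA' (≅-sym B ⟨ [] ∣ M n ∷ [] ⟩ eB))

RReversible : Game → Game → Set
RReversible K C = ∃ λ D → D ∈ leftOpts C × D ≥E K

RReversible-conj : ∀ K C → RReversible K C → LReversible (conj K) (conj C)
RReversible-conj K C (D , p , le) = conj D , ∈right-conj C p , ≥E-conj D K le

right-reversible-unique : ∀ K C D → LocallyReduced K → C ∈ rightOpts K → D ∈ rightOpts K →
  RReversible K C → RReversible K D → C ≅ D
right-reversible-unique K C D lr p q r s = ≅-conj⁻ C D
  (left-reversible-unique (conj K) (conj C) (conj D) (locallyReduced-conj K lr)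
    (∈left-conj K p) (∈left-conj K q) (RReversible-conj K C r) (RReversible-conj K D s))

reversible⇒REndRev : ∀ K C → LocallyReduced K → C ∈ rightOpts K → RReversible K C → REndRev K C
reversible⇒REndRev K C (_ , n) p (D , q , le) with empty-or-∈ (rightOpts D)
... | inj₁ e = D , q , e , le
... | inj₂ (D' , q') = contradiction (inj₂ (inj₁ (inj₂ (C , p , D , q , le , D' , q')))) n

right-dominated : ∀ K A B → LocallyReduced K → A ∈ rightOpts K → B ∈ rightOpts K →
  A ≥E B → A ≅ B
right-dominated K A B (_ , n) p q le =
  ≅-stable A B λ neq → n (inj₁ (inj₂ (A , B , p , q , neq , le)))

-- The surviving option `x` keeps the root from becoming a Left-end, and its Right options are those
-- of `K`, so no new end arises.
deadEnding-delL : ∀ K A → DeadEnding K → x ∈ removeI A (leftOpts K) → DeadEnding (delL K A)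
deadEnding-delL K A d p = deadEnding-intro
  (λ q → deadEnding-left d (proj₁ (∈-removeI⁻ A (leftOpts K) q)))
  (deadEnding-right d)
  (λ e → ⊥-elim (∉-[] e p))
  (λ e {x} q H f → proj₂ (d K here) e H (viaL (proj₁ (∈-removeI⁻ A (leftOpts K) q)) f))

deadEnding-delR : ∀ K A → DeadEnding K → x ∈ removeI A (rightOpts K) → DeadEnding (delR K A)
deadEnding-delR K A d p = deadEnding-intro
  (deadEnding-left d)
  (λ q → deadEnding-right d (proj₁ (∈-removeI⁻ A (rightOpts K) q)))
  (λ e {x} q H f → proj₁ (d K here) e H (viaR (proj₁ (∈-removeI⁻ A (rightOpts K) q)) f))
  (λ e → ⊥-elim (∉-[] e p))

left-fundamental : ∀ K A → LocallyReduced K → A ∈ leftOpts K → LReversible K A →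
  DeadEnding (delL K A) → ¬ ¬ LFundamental K A
left-fundamental K A lr@(_ , n) p rev d nf =
  n (inj₂ (inj₂ (inj₁ (inj₁ (A , p , reversible⇒LEndRev K A lr p rev , nf , d)))))

right-fundamental : ∀ K C → LocallyReduced K → C ∈ rightOpts K → RReversible K C →
  DeadEnding (delR K C) → ¬ ¬ RFundamental K C
right-fundamental K C lr@(_ , n) p rev d nf =
  n (inj₂ (inj₂ (inj₁ (inj₂ (C , p , reversible⇒REndRev K C lr p rev , nf , d)))))

-- Reduced games equivalent to Left-ends

reduced-leftEnd : ∀ G → Reduced G → ∀ G' → DeadEnding G' → LeftEnd G' →
  G ≥E G' → G' ≥E G → LeftEnd G
reduced-leftEnd = game-ind _ step
  where
  step : ∀ G → _ → (∀ {x} → x ∈ rightOpts G → Reduced x → ∀ G' → DeadEnding G' → LeftEnd G' →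
    x ≥E G' → G' ≥E x → LeftEnd x) → Reduced G → ∀ G' → DeadEnding G' → LeftEnd G' →
    G ≥E G' → G' ≥E G → LeftEnd G
  step G _ ih red G' d' e' G≥G' G'≥G with empty-or-∈ (leftOpts G)
  ... | inj₁ e = e
  ... | inj₂ (A , p) = ⊥-elim (absurd do
          r ← left-reversible p
          f ← left-fundamental G A lr p r delL-deadEnding
          pure (not-fundamental f))
    where
    d = proj₁ red
    lr = proj₂ red G here
    dead' = deadEnding⇒deadLeftEnd d' e'

    -- `G'` has no Left option to offer above `a`, so `G' ≥E G` must yield a reversing option below
    -- `G'`, hence below `G`.
    left-reversible : ∀ {a} → a ∈ leftOpts G → ¬ ¬ LReversible G a
    left-reversible q = do
      inj₂ (b , r , le) ← ≥E-left G' G G'≥G q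
        where inj₁ (_ , r , _) → ⊥-elim (∉-[] e' r)
      pure (b , r , ≥E-trans G G' b G≥G' le)

    left-unique : ∀ {a} → a ∈ leftOpts G → a ≅ A
    left-unique {a} q = ≅-stable a A do
      r ← left-reversible q
      s ← left-reversible p
      pure (left-reversible-unique G a A lr q p r s)

    delL-leftEnd : LeftEnd (delL G A)
    delL-leftEnd = removeI-all A (leftOpts G) left-unique

    -- Without `A` no Left option remains, and Left, to move without a move beside any Left-end,
    -- wins.
    not-fundamental : ¬ LFundamental G A
    not-fundamental (_ , X , _ , e , o) =
      L≢R (oL-end (delL G A + X) (leftEnd-+ (delL G A) X delL-leftEnd e)) o

    not-both-singletons : ∀ {C} → C ∈ rightOpts G → RReversible G C →
      (∀ {x} → x ∈ rightOpts G → x ≅ C) → ¬ ¬ ⊥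
    not-both-singletons {C} q s u = do
      r ← left-reversible p
      pure (proj₂ lr (inj₂ (inj₂ (inj₂ (inj₁ (A , C , (p , λ _ → left-unique) , (q , λ _ → u) ,
        reversible⇒LEndRev G A lr p r , reversible⇒REndRev G C lr q s))))))

    -- Any Right move in the dead Left-end `G'` leaves Left without a move, which loses for Right;
    -- so Right wins only by having no move.
    rightEnd' : oR (G' + 𝟎) ≡ R → RightEnd G'
    rightEnd' o with oR-win⁻ (G' + 𝟎) o
    ... | inj₁ end = proj₁ (rightEnd-+⁻ G' 𝟎 end)
    ... | inj₂ (_ , q , o') with ∈right-+⁻ G' 𝟎 q
    ... | inj₁ (x , r , refl) = ⊥-elim (L≢R
            (oL-end (x + 𝟎) (leftEnd-+ x 𝟎 (dead' x (viaR r here)) refl)) o')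

    𝟎-deadEnding : DeadEnding 𝟎
    𝟎-deadEnding = waiting-deadEnding 0

    -- If `C` is the only Right option, (R4) applies. Otherwise deleting `C` stays dead-ending, so
    -- `C` is fundamental by (R3); its strong outcome at the context `𝟎` makes `G'` a Right-end.
    -- Then every Right option of `G` is reversible, hence identical to `C`, and (R4) applies again.
    right-irreversible : ∀ {C} → C ∈ rightOpts G → RReversible G C → ¬ ¬ ⊥
    right-irreversible {C} q s with empty-or-∈ (removeI C (rightOpts G))
    ... | inj₁ e = not-both-singletons q s λ {x} r →
            ≅-stable x C λ n → ∉-[] e (∈-removeI C r n)
    ... | inj₂ (_ , r) = do
      w , _ ← right-fundamental G C lr q s (deadEnding-delR G C d r)
      let end' = rightEnd' (≢L⇒R λ o → L≢R (≥E-oR G G' G≥G' 𝟎-deadEnding o)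
            (w 𝟎 𝟎-deadEnding refl))
      not-both-singletons q s λ {x} t → ≅-stable x C do
        inj₂ (D , u , le) ← ≥E-right G G' G≥G' t
          where inj₁ (_ , u , _) → ⊥-elim (∉-[] end' u)
        pure (right-reversible-unique G x C lr t q (D , u , ≥E-trans D G' G le G'≥G) s)

    right-leftEnd : ∀ {C} → C ∈ rightOpts G → LeftEnd C
    right-leftEnd {C} q = []-stable do
      inj₁ (c , r , C≥c) ← ≥E-right G G' G≥G' q
        where inj₂ (D , r , le) → λ _ → absurd
                (right-irreversible q (D , r , ≥E-trans D G' G le G'≥G))
      inj₁ (B , s , c≥B) ← ≥E-right G' G G'≥G r
        where inj₂ (_ , s , _) → ⊥-elim (∉-[] (dead' c (viaR r here)) s)
      -- The round trip from `C` through `c` ends at a Right option of `G` below `C`. By (R1) it is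
      -- `C` itself, so `C` is equivalent to the Left-end `c`.
      let C≅B = right-dominated G C B lr q s (≥E-trans C c B C≥c c≥B)
          c≥C = ≥E-trans c B C c≥B (≅⇒≥E B C (≅-sym C B C≅B))
      pure (ih q (reduced-follower red (viaR q here)) c (deadEnding-right d' r)
        (dead' c (viaR r here)) C≥c c≥C)

    delL-deadEnding : DeadEnding (delL G A)
    delL-deadEnding = deadEnding-intro
      (λ q → ⊥-elim (∉-[] delL-leftEnd q))
      (deadEnding-right d)
      (λ _ q → deadEnding⇒deadLeftEnd (deadEnding-right d q) (right-leftEnd q))
      (λ _ q → ⊥-elim (∉-[] delL-leftEnd q))

-- Options of a reduced game are matched in equivalent games

-- The recursion passes from `Y` to a Right option `k` of `X` with `G ≥E k`, and from `X` to a Left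
-- option of `k` above `A`; `n` bounds the decreasing rank of `X`.
irreversible-matched : ∀ n G A Y X → LocallyReduced G → A ∈ leftOpts G → ¬ LReversible G A →
  DeadEnding Y → G ≥E Y → X ∈ leftOpts Y → X ≥E A → rank X < n →
  ¬ ¬ ∃ λ Z → DeadEnding Z × A ≥E Z × Z ≥E A × rank Z ≤ rank X
irreversible-matched (suc n) G A Y X lr A∈ irr d G≥Y X∈ X≥A lt = do
  inj₂ (k , k∈ , G≥k) ← ≥E-left G Y G≥Y X∈
    where
    -- Since `g` lies above `X` and so above `A`, (R1) gives `A ≅ g`, and `X` itself is equivalent
    -- to `A`.
    inj₁ (g , g∈ , g≥X) → pure (X , deadEnding-left d X∈ ,
      ≥E-trans A g X (≅⇒≥E A g (left-dominated G A g lr A∈ g∈ (≥E-trans g X A g≥X X≥A))) g≥X ,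
      X≥A , ≤-refl)
  -- A Right option of `A` below `k` would also be below `G` and would reverse `A`.
  inj₂ (l , l∈ , l≥A) ← ≥E-right X A X≥A k∈
    where inj₁ (a , a∈ , k≥a) → ⊥-elim (irr (a , a∈ , ≥E-trans G k a G≥k k≥a))
  let l<X = ≤-<-trans (<⇒≤ (rank-left k l∈)) (rank-right X k∈)
  Z , dZ , A≥Z , Z≥A , le ← irreversible-matched n G A k l lr A∈ irr
    (deadEnding-right (deadEnding-left d X∈) k∈) G≥k l∈ l≥A (<-≤-trans l<X (s≤s⁻¹ lt))
  pure (Z , dZ , A≥Z , Z≥A , ≤-trans le (<⇒≤ l<X))

-- P abstracts what Left preserves while answering Right's reversing moves: that she is
-- winning in a fixed context, or nothing at all.
module _ (G A : Game) (m : ℕ) (A≅ : A ≅ ⟨ [] ∣ M m ∷ [] ⟩) (G≥M : G ≥E M m)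
  (P : Game → Set)
  (P-reply : ∀ {Z z} → P Z → z ∈ rightOpts Z → LeftEnd z ⊎ ∃ λ l → l ∈ leftOpts z × P l)
  (P-only : ∀ {Z g} → P Z → g ∈ leftOpts G → g ≥E Z → g ≅ A)
  where

  -- Right moves from `Z` to some `z` below `G`. Either `z` is the Left-end sought, or Left has a
  -- reply that keeps `P`, and the situation recurs with `z` for `Y` at smaller rank.
  leftEnd-below : ∀ n Y Z → DeadEnding Y → G ≥E Y → Z ∈ leftOpts Y → P Z → rank Z < n →
    ¬ ¬ ∃ λ B → DeadLeftEnd B × G ≥E B × rank B < rank Z
  leftEnd-below (suc n) Y Z d G≥Y Z∈ PZ lt = do
    z , z∈ , G≥z ← reverting
    inj₂ (l , l∈ , Pl) ← pure (P-reply PZ z∈)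
      where inj₁ e → pure (z , deadEnding⇒deadLeftEnd (deadEnding-right dZ z∈) e , G≥z , rank-right Z z∈)
    let l<Z = ≤-<-trans (<⇒≤ (rank-left z l∈)) (rank-right Z z∈)
    B , dB , G≥B , B<l ← leftEnd-below n z l (deadEnding-right dZ z∈) G≥z l∈ Pl
      (<-≤-trans l<Z (s≤s⁻¹ lt))
    pure (B , dB , G≥B , ≤-<-trans (<⇒≤ B<l) l<Z)
    where
    dZ = deadEnding-left d Z∈
    μ = ⟨ [] ∣ M m ∷ [] ⟩
    -- If `Z` is instead below a Left option of `G`, that option is `μ`. Its Right option `M m` has
    -- no Left option, so it must lie above a Right option of `Z`, and `G` lies above `M m`.
    reverting : ¬ ¬ ∃ λ z → z ∈ rightOpts Z × G ≥E z
    reverting = do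
      inj₁ (g , g∈ , g≥Z) ← ≥E-left G Y G≥Y Z∈
        where inj₂ (z , z∈ , G≥z) → pure (z , z∈ , G≥z)
      let g≅μ = ≅-trans g A μ (P-only PZ g∈ g≥Z) A≅
      inj₁ (z , z∈ , M≥z) ← ≥E-right μ Z
          (≥E-trans μ g Z (≅⇒≥E μ g (≅-sym g μ g≅μ)) g≥Z) (here refl)
        where inj₂ (_ , k∈ , _) → ⊥-elim (∉-[] (M-leftEnd m) k∈)
      pure (z , z∈ , ≥E-trans G (M m) z G≥M M≥z)

murder-bound : ∀ G A m → LeastAboveM G m → A ≅ ⟨ [] ∣ M m ∷ [] ⟩ →
  ∀ B → DeadLeftEnd B → G ≥E B → rank A ≤ suc (rank B)
murder-bound G A m (_ , least) A≅ B dB G≥B =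
  ≤-trans (≅⇒rank≤ A μ A≅) (rank-lub μ (λ ()) λ where
    (here refl) → s≤s (≤-trans (rank-M≤ m)
      (≮⇒≥ λ lt → least (rank B) lt (≥E-trans G B (M (rank B)) G≥B (deadLeftEnd≥M B dB)))))
  where μ = ⟨ [] ∣ M m ∷ [] ⟩

-- If deleting `A` leaves the dead-ending class, `A` is the only Left option and any play in `G'`
-- will do. Otherwise `A` is fundamental, and play is steered by wins beside the witnessing Left-end
-- `X`.
reversible-rank : ∀ G G' A → Reduced G → DeadEnding G' → G ≥E G' → G' ≥E G →
  A ∈ leftOpts G → LReversible G A → ¬ ¬ (rank A < rank G')
reversible-rank G G' A red d' G≥G' G'≥G A∈ rev with empty-or-∈ (leftOpts G')
... | inj₁ e' = ⊥-elim (∉-[] (reduced-leftEnd G red G' d' e' G≥G' G'≥G) A∈)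
... | inj₂ (Z₀ , Z₀∈) = do
  m , least , A≅ ← reversible-murder G A lr A∈ rev
  let finish : ¬ ¬ (∃ λ Z → Z ∈ leftOpts G' ×
        ∃ λ B → DeadLeftEnd B × G ≥E B × rank B < rank Z) → ¬ ¬ (rank A < rank G')
      finish s = do
        Z , Z∈ , B , dB , G≥B , B<Z ← s
        -- `rank A` is at most `suc (rank B)`, hence at most `rank Z`, which is below `rank G'`.
        pure (≤-<-trans (≤-trans (murder-bound G A m least A≅ B dB G≥B) B<Z) (rank-left G' Z∈))
  yes dd ← ¬¬-excluded-middle {A = DeadEnding (delL G A)}
    where
    no nd → finish do
      B ← leftEnd-below G A m A≅ (proj₁ least) (λ _ → ⊤) (λ {_} {z} _ _ → reply z)
        -- A Left option other than `A` would survive the deletion and keep the result dead-ending.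
        (λ {_} {g} _ g∈ _ → ≅-stable g A λ n → nd (deadEnding-delL G A (proj₁ red) (∈-removeI A g∈ n)))
        _ G' Z₀ d' G≥G' Z₀∈ _ (n<1+n _)
      pure (Z₀ , Z₀∈ , B)
  w , X , dX , eX , o ← left-fundamental G A lr A∈ rev dd
  finish do
    Z , Z∈ , win ← winning-move X eX (≥E-oL G' G G'≥G dX (w X dX eX))
    B ← leftEnd-below G A m A≅ (proj₁ least) (λ Z → oR (Z + X) ≡ L)
      (λ {Z} {z} e z∈ → winning-reply z X eX (oR-lose⁻ (Z + X) e (∈right-+ˡ Z X z∈)))
      -- If `g` were not `A`, Left could still move to it in `delL G A + X` and win, against the
      -- choice of `X`.
      (λ {Z} {g} e g∈ g≥Z → ≅-stable g A λ n → L≢R (oL-win (delL G A + X)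
        (∈left-+ˡ (delL G A) X (∈-removeI A g∈ n)) (≥E-oR g Z g≥Z dX e)) o)
      _ G' Z d' G≥G' Z∈ win (n<1+n _)
    pure (Z , Z∈ , B)
  where
  lr = proj₂ red G here
  reply : ∀ z → LeftEnd z ⊎ ∃ λ l → l ∈ leftOpts z × ⊤
  reply z with empty-or-∈ (leftOpts z)
  ... | inj₁ e = inj₁ e
  ... | inj₂ (l , p) = inj₂ (l , p , _)
  winning-reply : ∀ z X → LeftEnd X → oL (z + X) ≡ L →
    LeftEnd z ⊎ ∃ λ l → l ∈ leftOpts z × oR (l + X) ≡ L
  winning-reply z X eX e with oL-win⁻ (z + X) e
  ... | inj₁ end = inj₁ (proj₁ (leftEnd-+⁻ z X end))
  ... | inj₂ (_ , p , e') with ∈left-+⁻ z X p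
  ... | inj₁ (l , q , refl) = inj₂ (l , q , e')
  ... | inj₂ (_ , q , _) = ⊥-elim (∉-[] eX q)
  winning-move : ∀ X → LeftEnd X → oL (G' + X) ≡ L →
    ¬ ¬ ∃ λ Z → Z ∈ leftOpts G' × oR (Z + X) ≡ L
  winning-move X eX e with winning-reply G' X eX e
  ... | inj₁ end = ⊥-elim (∉-[] end Z₀∈)
  ... | inj₂ move = pure move

-- `ih` is the rank bound for the single option `A`; in this form it can also be supplied for the
-- conjugate of a Right option.
left-option-rank : ∀ G G' A → Reduced G → DeadEnding G' → G ≥E G' → G' ≥E G → A ∈ leftOpts G →
  (∀ Z → DeadEnding Z → A ≥E Z → Z ≥E A → rank A ≤ rank Z) → rank A < rank G'
left-option-rank G G' A red d' G≥G' G'≥G A∈ ih = decidable-stable (rank A <? rank G') do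
  no irr ← ¬¬-excluded-middle {A = LReversible G A}
    where yes rev → reversible-rank G G' A red d' G≥G' G'≥G A∈ rev
  inj₁ (X , X∈ , X≥A) ← ≥E-left G' G G'≥G A∈
    where inj₂ (B , B∈ , le) → ⊥-elim (irr (B , B∈ , ≥E-trans G G' B G≥G' le))
  Z , dZ , A≥Z , Z≥A , le ← irreversible-matched _ G A G' X (proj₂ red G here) A∈ irr
    d' G≥G' X∈ X≥A (n<1+n _)
  pure (≤-<-trans (≤-trans (ih Z dZ A≥Z Z≥A) le) (rank-left G' X∈))

-- Comparison of ranks by induction on the game

rank≤rank-conj : ∀ G → rank G ≤ rank (conj G)
rank≤rank-conj G = subst (λ z → rank z ≤ rank (conj G)) (conj-conj G) (rank-conj≤ (conj G))

reduced-rank : ∀ G G' → Reduced G → DeadEnding G' → G ≥E G' → G' ≥E G → rank G ≤ rank G'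
reduced-rank = game-ind _ λ G f g G' red d' G≥G' G'≥G → rank-lub G
  (λ {A} p → left-option-rank G G' A red d' G≥G' G'≥G p
    λ Z dZ → f p Z (reduced-follower red (viaL p here)) dZ)
  (λ {C} p → ≤-<-trans (rank≤rank-conj C) (<-≤-trans
    (left-option-rank (conj G) (conj G') (conj C) (reduced-conj G red) (deadEnding-conj d')
      (≥E-conj G' G G'≥G) (≥E-conj G G' G≥G') (∈left-conj G p)
      λ Z dZ C≥Z Z≥C → ≤-trans (rank-conj≤ C) (≤-trans
        (g p (conj Z) (reduced-follower red (viaR p here)) (deadEnding-conj dZ)
          (≥E-conjʳ Z C Z≥C) (≥E-conjˡ C Z C≥Z))
        (rank-conj≤ Z)))
    (rank-conj≤ G')))

mainTheorem13 : (G G' : Game) → DeadEnding G → Reduced G →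
    DeadEnding G' → G' ≡E G → rank G ≤ rank G'
mainTheorem13 G G' _ red d' (G'≥G , G≥G') = reduced-rank G G' red d' G≥G' G'≥G
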